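{- For every $n$, the quotient lattice $S_n/\mathcal{H}(\{3412,2413\})_n$ is isomorphic to the subposet of the weak order on $S_n$ induced by the twisted Baxter permutations.
   Context: $S_n$: permutations of $[n]$ in one-line notation with the right weak order (inclusion of sets of inverted value pairs), a lattice. A permutation $x$ is a twisted Baxter permutation if (i) in every occurrence of the pattern 2413 in $x$, the entries playing the roles of "4" and "1" are not adjacent in $x$, and (ii) in every occurrence of 3412, the "4" and "1" are not adjacent. (Pattern $y\in S_k$ occurs in $x$ if there are $i_1<\dots<i_k$ with $x_{i_p}<x_{i_q}\iff y_p<y_q$.) Join-irreducibles of $S_n$ are permutations with exactly one descent; $\gamma_*$ is the unique element they cover. A congruence contracts $\gamma$ if $\gamma\equiv\gamma_*$. $u\times v=u_1\cdots u_p(p+v_1)\cdots(p+v_q)$; $\mathrm{st}(a_1..a_k)$ is the $u\in S_k$ with $u_i<u_j\iff a_i<a_j$. A family $\{\Theta_n\}_{n\ge0}$ of lattice congruences on $S_n$ is translational if $u\times v\equiv u'\times v'$ mod $\Theta_{p+q}$ iff $u\equiv u'$ mod $\Theta_p$ and $v\equiv v'$ mod $\Theta_q$; insertional if for every $p$-subset $Q\subseteq[p+q]$, with $\varphi_Q(u,v)$ the unique $x\in S_{p+q}$ with $\{x_1..x_p\}=Q$, $\mathrm{st}(x_1..x_p)=u$, $\mathrm{st}(x_{p+1}..x_{p+q})=v$, we have $u\equiv u',v\equiv v'\Rightarrow\varphi_Q(u,v)\equiv\varphi_Q(u',v')$; an $\mathcal{H}$-family if both. For a set $C$ of join-irreducibles,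 $\{\mathcal{H}(C)_n\}$ is the smallest $\mathcal{H}$-family contracting every element of $C$. The quotient $L/\Theta$ is the set of classes with $[a]\le[b]$ iff some $x\in[a],y\in[b]$ have $x\le y$. -}

module Defs where

open import Data.Fin.Base using (Fin; toℕ; _<_; _↑ˡ_; _↑ʳ_)
open import Data.Fin.Patterns using (0F; 1F; 2F; 3F)
open import Data.Fin.Permutation
  using (Permutation′; permutation; _⟨$⟩ʳ_; _⟨$⟩ˡ_; _≈_)
open import Data.Fin.Properties using (+↔⊎)
open import Data.Fin.Subset using (Subset; _∈_; ∣_∣)
open import Data.Nat.Base using (ℕ; zero; suc; _+_; z≤n; s≤s)
open import Data.Product.Base using (Σ; ∃; ∃-syntax; _×_; _,_; proj₁; proj₂)
open import Data.Product using (∃!)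
open import Data.Sum.Base using (_⊎_)
open import Data.Sum.Function.Propositional using (_⊎-↔_)
open import Data.Vec.Base using (Vec; []; _∷_; lookup)
open import Function.Base using (_∘_; _on_)
open import Function.Bundles using (_⇔_; mk⇔; Equivalence)
open import Function.Construct.Composition using (_↔-∘_)
open import Function.Construct.Symmetry using (↔-sym)
open import Level using (Level; 0ℓ; _⊔_)
open import Relation.Binary.Bundles.Raw using (RawRelation)
open import Relation.Binary.Core using (Rel; _⇒_)
open import Relation.Binary.Morphism.Structures using (IsOrderIsomorphism)
open import Relation.Binary.PropositionalEquality using (_≡_; refl)
open import Relation.Binary.Structures using (IsEquivalence)
open import Relation.Nullary.Negation using (¬_)

private
  variable
    ℓ c₁ c₂ ℓ₁ ℓ₂ ℓ₃ ℓ₄ : Level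
    k m n : ℕ

-- The one-line notation of x is  x ⟨$⟩ʳ 0 , x ⟨$⟩ʳ 1 , … , so x ⟨$⟩ʳ_ sends
-- positions to values and x ⟨$⟩ˡ_ sends values to positions.  Positions and
-- values are counted from 0, and permutations are compared by _≈_.
Perm : ℕ → Set
Perm = Permutation′

------------------------------------------------------------------------
-- The weak order

-- The value pair a < b is inverted in x when b stands to the left of a.
Inverted : Perm n → Fin n → Fin n → Set
Inverted x a b = a < b × x ⟨$⟩ˡ b < x ⟨$⟩ˡ a

infix 4 _≤ʷ_ _<ʷ_ _⋖_

_≤ʷ_ : Rel (Perm n) 0ℓ
x ≤ʷ y = ∀ a b → Inverted x a b → Inverted y a b

_<ʷ_ : Rel (Perm n) 0ℓ
x <ʷ y = x ≤ʷ y × ¬ (x ≈ y)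

-- x is covered by y
_⋖_ : Rel (Perm n) 0ℓ
x ⋖ y = x <ʷ y × ¬ (∃[ z ] (x <ʷ z × z <ʷ y))

IsJoin : Perm n → Perm n → Perm n → Set
IsJoin x y j = x ≤ʷ j × y ≤ʷ j × (∀ z → x ≤ʷ z → y ≤ʷ z → j ≤ʷ z)

IsMeet : Perm n → Perm n → Perm n → Set
IsMeet x y m = m ≤ʷ x × m ≤ʷ y × (∀ z → z ≤ʷ x → z ≤ʷ y → z ≤ʷ m)

-- i is the left one of the two positions of the descent
IsDescent : Perm n → Fin n → Set
IsDescent x i = ∃[ j ] (toℕ j ≡ suc (toℕ i) × x ⟨$⟩ʳ j < x ⟨$⟩ʳ i)

IsJoinIrreducible : Perm n → Set
IsJoinIrreducible x = ∃! _≡_ (IsDescent x)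

------------------------------------------------------------------------
-- Lattice congruences

-- The operations of the weak order enter through their universal
-- properties: any join of x and y is related to any join of x′ and y′, and
-- likewise for meets.
record IsLatticeCongruence (_∼_ : Rel (Perm n) ℓ) : Set ℓ where
  field
    isEquivalence : IsEquivalence _∼_
    reflexive     : _≈_ ⇒ _∼_
    ∨-cong        : ∀ {x x′ y y′ j j′} → IsJoin x y j → IsJoin x′ y′ j′ →
                    x ∼ x′ → y ∼ y′ → j ∼ j′
    ∧-cong        : ∀ {x x′ y y′ m m′} → IsMeet x y m → IsMeet x′ y′ m′ →
                    x ∼ x′ → y ∼ y′ → m ∼ m′

-- For a join-irreducible γ the only element covered by γ is γ_*.
Contracts : Rel (Perm n) ℓ → Perm n → Set ℓ
Contracts _∼_ γ = ∀ {γ* } → γ* ⋖ γ → γ ∼ γ*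

-- [ x ] ≤ [ y ] in the quotient
QuotientOrder : Rel (Perm n) ℓ → Rel (Perm n) ℓ
QuotientOrder _∼_ x y = ∃[ x′ ] ∃[ y′ ] (x ∼ x′ × y ∼ y′ × x′ ≤ʷ y′)

-- The quotient as a setoid: a class is given by any of its elements, and
-- two elements are equal when they are congruent.
_/_ : ∀ n → Rel (Perm n) ℓ → RawRelation 0ℓ ℓ ℓ
n / _∼_ = record
  { Carrier = Perm n
  ; _≈_     = _∼_
  ; _∼_     = QuotientOrder _∼_
  }

------------------------------------------------------------------------
-- 𝓗-families

-- u₁ ⋯ u_p (p + v₁) ⋯ (p + v_q)
infixr 7 _×ₚ_

_×ₚ_ : ∀ {p q} → Perm p → Perm q → Perm (p + q)
_×ₚ_ {p} u v = ↔-sym (+↔⊎ {p}) ↔-∘ ((u ⊎-↔ v) ↔-∘ +↔⊎ {p})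

-- st (a₁ ⋯ a_k) = u
IsStandardization : (Fin k → Fin m) → Perm k → Set
IsStandardization a u = ∀ i j → (u ⟨$⟩ʳ i < u ⟨$⟩ʳ j) ⇔ (a i < a j)

-- φ_Q (u , v) = x, where x is determined up to _≈_ once Q has p elements
record Isφ {p q} (Q : Subset (p + q)) (u : Perm p) (v : Perm q)
           (x : Perm (p + q)) : Set where
  field
    values : ∀ a → a ∈ Q ⇔ (∃[ i ] x ⟨$⟩ʳ (i ↑ˡ q) ≡ a)
    left   : IsStandardization (λ i → x ⟨$⟩ʳ (i ↑ˡ q)) u
    right  : IsStandardization (λ j → x ⟨$⟩ʳ (p ↑ʳ j)) v

Family : (ℓ : Level) → Set (Level.suc ℓ)
Family ℓ = ∀ n → Rel (Perm n) ℓ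

Translational : Family ℓ → Set ℓ
Translational Θ = ∀ {p q} {u u′ : Perm p} {v v′ : Perm q} →
  Θ (p + q) (u ×ₚ v) (u′ ×ₚ v′) ⇔ (Θ p u u′ × Θ q v v′)

Insertional : Family ℓ → Set ℓ
Insertional Θ = ∀ {p q} (Q : Subset (p + q)) → ∣ Q ∣ ≡ p →
  ∀ {u u′ : Perm p} {v v′ : Perm q} {x x′} → Isφ Q u v x → Isφ Q u′ v′ x′ →
  Θ p u u′ → Θ q v v′ → Θ (p + q) x x′

record IsHFamily (Θ : Family ℓ) : Set ℓ where
  field
    isLatticeCongruence : ∀ n → IsLatticeCongruence (Θ n)
    translational       : Translational Θ
    insertional         : Insertional Θ

-- A set of join-irreducibles, possibly from several weak orders
record JoinIrreducibles : Set₁ where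
  field
    Mem              : Perm n → Set
    joinIrreducible  : {γ : Perm n} → Mem γ → IsJoinIrreducible γ

ContractsAll : JoinIrreducibles → Family ℓ → Set ℓ
ContractsAll C Θ = ∀ {n} {γ : Perm n} → JoinIrreducibles.Mem C γ →
                   Contracts (Θ n) γ

-- The family generated by the contractions under the closure conditions
-- of an 𝓗-family.  By the three results following it, it is the smallest
-- 𝓗-family contracting every element of C.
data 𝓗 (C : JoinIrreducibles) : Family 0ℓ where
  contract   : ContractsAll C (𝓗 C)
  reflexive  : ∀ {n} {x y : Perm n} → x ≈ y → 𝓗 C n x y
  symmetric  : ∀ {n x y} → 𝓗 C n x y → 𝓗 C n y x
  transitive : ∀ {n x y z} → 𝓗 C n x y → 𝓗 C n y z → 𝓗 C n x z
  join       : ∀ {n x x′ y y′ j j′} → IsJoin x y j → IsJoin x′ y′ j′ →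
               𝓗 C n x x′ → 𝓗 C n y y′ → 𝓗 C n j j′
  meet       : ∀ {n x x′ y y′ m m′} → IsMeet x y m → IsMeet x′ y′ m′ →
               𝓗 C n x x′ → 𝓗 C n y y′ → 𝓗 C n m m′
  product    : ∀ {p q} {u u′ : Perm p} {v v′ : Perm q} →
               𝓗 C p u u′ → 𝓗 C q v v′ → 𝓗 C (p + q) (u ×ₚ v) (u′ ×ₚ v′)
  factorˡ    : ∀ {p q} {u u′ : Perm p} {v v′ : Perm q} →
               𝓗 C (p + q) (u ×ₚ v) (u′ ×ₚ v′) → 𝓗 C p u u′
  factorʳ    : ∀ {p q} {u u′ : Perm p} {v v′ : Perm q} →
               𝓗 C (p + q) (u ×ₚ v) (u′ ×ₚ v′) → 𝓗 C q v v′
  insert     : Insertional (𝓗 C)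

𝓗-isHFamily : ∀ C → IsHFamily (𝓗 C)
𝓗-isHFamily C = record
  { isLatticeCongruence = λ n → record
    { isEquivalence = record
      { refl  = reflexive (λ _ → refl)
      ; sym   = symmetric
      ; trans = transitive
      }
    ; reflexive = reflexive
    ; ∨-cong    = join
    ; ∧-cong    = meet
    }
  ; translational = mk⇔ (λ h → factorˡ h , factorʳ h) (λ (h , k) → product h k)
  ; insertional   = insert
  }

𝓗-contracts : ∀ C → ContractsAll C (𝓗 C)
𝓗-contracts C = contract

𝓗-smallest : ∀ C (Θ : Family ℓ) → IsHFamily Θ → ContractsAll C Θ →
             ∀ {n x y} → 𝓗 C n x y → Θ n x y
𝓗-smallest C Θ isH contractsΘ = go
  where
  open IsHFamily isH
  module L {n} = IsLatticeCongruence (isLatticeCongruence n)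
  module E {n} = IsEquivalence (L.isEquivalence {n})

  go : ∀ {n x y} → 𝓗 C n x y → Θ n x y
  go (contract γ∈C c)        = contractsΘ γ∈C c
  go (reflexive e)           = L.reflexive e
  go (symmetric h)           = E.sym (go h)
  go (transitive h k)        = E.trans (go h) (go k)
  go (join j j′ h k)         = L.∨-cong j j′ (go h) (go k)
  go (meet m m′ h k)         = L.∧-cong m m′ (go h) (go k)
  go (product h k)           = Equivalence.from translational (go h , go k)
  go (factorˡ h)             = proj₁ (Equivalence.to translational (go h))
  go (factorʳ h)             = proj₂ (Equivalence.to translational (go h))
  go (insert Q ∣Q∣≡p f f′ h k) = insertional Q ∣Q∣≡p f f′ (go h) (go k)

------------------------------------------------------------------------
-- The permutations 2413 and 3412

perm2413 : Perm 4
perm2413 = permutation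
  (lookup (1F ∷ 3F ∷ 0F ∷ 2F ∷ []))
  (lookup (2F ∷ 0F ∷ 3F ∷ 1F ∷ []))
  (λ { 0F → refl ; 1F → refl ; 2F → refl ; 3F → refl })
  (λ { 0F → refl ; 1F → refl ; 2F → refl ; 3F → refl })

perm3412 : Perm 4
perm3412 = permutation
  (lookup (2F ∷ 3F ∷ 0F ∷ 1F ∷ []))
  (lookup (2F ∷ 3F ∷ 0F ∷ 1F ∷ []))
  (λ { 0F → refl ; 1F → refl ; 2F → refl ; 3F → refl })
  (λ { 0F → refl ; 1F → refl ; 2F → refl ; 3F → refl })

data Generator : Perm n → Set where
  g3412 : Generator perm3412
  g2413 : Generator perm2413

generator-joinIrreducible : {γ : Perm n} → Generator γ → IsJoinIrreducible γ
generator-joinIrreducible g3412 = 1F , (2F , refl , s≤s z≤n) , unique _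
  where
  unique : ∀ i → IsDescent perm3412 i → 1F ≡ i
  unique 0F (1F , _ , s≤s (s≤s ()))
  unique 1F _ = refl
  unique 2F (3F , _ , ())
generator-joinIrreducible g2413 = 1F , (2F , refl , s≤s z≤n) , unique _
  where
  unique : ∀ i → IsDescent perm2413 i → 1F ≡ i
  unique 0F (1F , _ , s≤s ())
  unique 1F _ = refl
  unique 2F (3F , _ , ())

⟨3412,2413⟩ : JoinIrreducibles
⟨3412,2413⟩ = record
  { Mem             = Generator
  ; joinIrreducible = generator-joinIrreducible
  }

------------------------------------------------------------------------
-- Twisted Baxter permutations

record Occurrence (y : Perm k) (x : Perm n) : Set where
  field
    index      : Fin k → Fin n
    increasing : ∀ {i j} → i < j → index i < index j
    sameOrder  : IsStandardization (λ i → x ⟨$⟩ʳ index i) y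

Adjacent : Rel (Fin n) 0ℓ
Adjacent i j = toℕ j ≡ suc (toℕ i) ⊎ toℕ i ≡ suc (toℕ j)

-- The entry playing the role of the value a of y is at position
-- index (y ⟨$⟩ˡ a) of x; the values "4" and "1" of y are 3F and 0F.
FourOneNeverAdjacent : Perm 4 → Perm n → Set
FourOneNeverAdjacent y x = (o : Occurrence y x) → let open Occurrence o in
  ¬ Adjacent (index (y ⟨$⟩ˡ 3F)) (index (y ⟨$⟩ˡ 0F))

IsTwistedBaxter : Perm n → Set
IsTwistedBaxter x =
  FourOneNeverAdjacent perm2413 x × FourOneNeverAdjacent perm3412 x

TwistedBaxter : ℕ → RawRelation 0ℓ 0ℓ 0ℓ
TwistedBaxter n = record
  { Carrier = Σ (Perm n) IsTwistedBaxter
  ; _≈_     = _≈_ on proj₁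
  ; _∼_     = _≤ʷ_ on proj₁
  }

------------------------------------------------------------------------

infix 4 _≅_

_≅_ : RawRelation c₁ ℓ₁ ℓ₂ → RawRelation c₂ ℓ₃ ℓ₄ →
      Set (c₁ ⊔ c₂ ⊔ ℓ₁ ⊔ ℓ₂ ⊔ ℓ₃ ⊔ ℓ₄)
P ≅ Q = ∃ (IsOrderIsomorphism P._≈_ Q._≈_ P._∼_ Q._∼_)
  where
  module P = RawRelation P
  module Q = RawRelation Q

{-# OPTIONS --safe #-}
-- In terms of descents, x is twisted Baxter iff no adjacent descent d a of x has
-- a value strictly between a and d on both of its sides.  Undoing such a descent
-- is a step inside 𝓗: letters other than d and a may be permuted among
-- themselves on either side by perspectivity, until e d a f is a factor with
-- a < e , f < d, and this factor is a generator placed by two insertions.  Hence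
-- every class of 𝓗 contains a twisted Baxter permutation.
--
-- Conversely, let S x be the set of pairs a < d such that a stands to the right
-- of all b with a < b ≤ d, and T x the set of those such that d stands to the
-- left of all b with a ≤ b < d.  Equality of S and of T is the twisted Baxter
-- congruence, and S and T are monotone.  They are compatible with meets because
-- S x ∩ S y is itself the inversion set of a permutation; the mirror images of S
-- and T, which they determine, do the same for joins.  The inversions of a
-- twisted Baxter permutation are generated under transitivity by S and T, so it
-- is the least element of its class and depends monotonically on that class.
module Submission where

open import Data.Bool.Base using (Bool; true; false; if_then_else_)
open import Data.Fin.Base
  using (Fin; zero; suc; toℕ; fromℕ<; remQuot; combine; _<_; _≤_; punchIn; _↑ˡ_; _↑ʳ_)
open import Data.Fin.Induction using (spo-noetherian)
open import Data.Fin.Patterns using (0F; 1F; 2F; 3F)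
open import Data.Fin.Permutation
  using (_⟨$⟩ʳ_; _⟨$⟩ˡ_; _≈_; _∘ₚ_; inverseˡ; inverseʳ; insert; transpose; id; flip; permutation)
open import Data.Fin.Properties
  using (_≟_; _<?_; any?; all?; <-cmp; <-trans; <-irrefl; <-asym; <-isStrictTotalOrder;
         ≤-antisym; ≤-trans; <⇒≢; ≤∧≢⇒<; punchIn-injective; punchIn-punchOut;
         toℕ-↑ˡ; toℕ-↑ʳ; ↑ˡ-injective; ↑ʳ-injective; splitAt-↑ˡ; splitAt-↑ʳ;
         toℕ<n; toℕ-injective; toℕ-fromℕ<; remQuot-combine; injective⇒existsPivot)
open import Data.Fin.Subset using (Subset; _∈_; _⊂_; ∣_∣)
open import Data.Fin.Subset.Induction using (⊂-wellFounded)
open import Data.Nat.Base as ℕ using (ℕ; z≤n; s≤s; z<s; s<s; s≤s⁻¹)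
import Data.Nat.Properties as ℕ
open import Data.Product.Base using (Σ; Σ-syntax; ∃; ∃-syntax; _×_; _,_; proj₁; proj₂)
open import Data.Sign.Base using (Sign; opposite) renaming (+ to ⊕; - to ⊖)
open import Data.Sum.Base using (_⊎_; inj₁; inj₂)
open import Data.Vec.Base using (tabulate; lookup; []; _∷_)
open import Data.Vec.Properties using (lookup∘tabulate; lookup⇒[]=; []=⇒lookup)
open import Function.Base using (_∘_; case_of_) renaming (flip to flip′)
open import Function.Bundles using (_⇔_; mk⇔; Equivalence)
open import Induction.WellFounded using (Acc; acc)
open import Level using (0ℓ)
import Relation.Binary.Construct.Flip.EqAndOrd as Flip
open import Relation.Binary.Core using (Rel)
open import Relation.Binary.Definitions using (Transitive; tri<; tri≈; tri>)
open import Relation.Binary.PropositionalEquality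
  using (_≡_; _≢_; refl; sym; trans; cong; subst; subst₂)
open import Relation.Binary.Structures using (IsStrictTotalOrder; IsEquivalence)
open import Relation.Nullary using (¬_; Dec; does; yes; no; contradiction)
open import Relation.Nullary.Decidable
  using (_×-dec_; _→-dec_; ¬?; dec-true; dec-false; decidable-stable; map′)
open import Algebra.Properties.CommutativeMonoid.Sum ℕ.+-0-commutativeMonoid
  using (sum; sum-permute; sum-cong-≗; sum-replicate-zero)
open import Defs renaming (insert to insert-𝓗; reflexive to reflexive-𝓗)

private
  variable
    k m n p q : ℕ

-- Positions, signed orders and increasing maps

pos : Perm n → Fin n → Fin n
pos = _⟨$⟩ˡ_

pos-injective : ∀ (x : Perm n) {a b} → pos x a ≡ pos x b → a ≡ b
pos-injective x e = trans (sym (inverseʳ x)) (trans (cong (x ⟨$⟩ʳ_) e) (inverseʳ x))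

val-injective : ∀ (x : Perm n) {i j} → x ⟨$⟩ʳ i ≡ x ⟨$⟩ʳ j → i ≡ j
val-injective x e = trans (sym (inverseˡ x)) (trans (cong (x ⟨$⟩ˡ_) e) (inverseˡ x))

≈⇒pos : ∀ (x y : Perm n) → x ≈ y → ∀ a → pos x a ≡ pos y a
≈⇒pos x y e a = val-injective y (trans (sym (e (pos x a))) (trans (inverseʳ x) (sym (inverseʳ y))))

≮∧≢⇒> : ∀ {i j : Fin n} → ¬ (i < j) → i ≢ j → j < i
≮∧≢⇒> {i = i} {j} i≮j i≢j with <-cmp i j
... | tri< i<j _ _ = contradiction i<j i≮j
... | tri≈ _ i≡j _ = contradiction i≡j i≢j
... | tri> _ _ j<i = j<i

infix 4 _<[_]_
-- The sign selects the order or its dual, for values as well as for positions, so that the four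
-- mirror images of an argument share a single proof.
_<[_]_ : Fin n → Sign → Fin n → Set
i <[ ⊕ ] j = i < j
i <[ ⊖ ] j = j < i

<[]-isStrictTotalOrder : ∀ s → IsStrictTotalOrder {A = Fin n} _≡_ (_<[ s ]_)
<[]-isStrictTotalOrder ⊕ = <-isStrictTotalOrder
<[]-isStrictTotalOrder ⊖ = Flip.isStrictTotalOrder <-isStrictTotalOrder

module Ord {n} (s : Sign) = IsStrictTotalOrder (<[]-isStrictTotalOrder {n} s)

<[]-opposite : ∀ s {i j : Fin n} → i <[ opposite s ] j → j <[ s ] i
<[]-opposite ⊕ h = h
<[]-opposite ⊖ h = h

<[]-opposite⁻ : ∀ s {i j : Fin n} → j <[ s ] i → i <[ opposite s ] j
<[]-opposite⁻ ⊕ h = h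
<[]-opposite⁻ ⊖ h = h

<[]-map : ∀ s {i j : Fin m} {i′ j′ : Fin n} → (i < j → i′ < j′) → (j < i → j′ < i′) →
          i <[ s ] j → i′ <[ s ] j′
<[]-map ⊕ f g = f
<[]-map ⊖ f g = g

<-total : ∀ {i j : Fin n} → i ≢ j → i < j ⊎ j < i
<-total {i = i} {j} i≢j with <-cmp i j
... | tri< i<j _ _ = inj₁ i<j
... | tri≈ _ i≡j _ = contradiction i≡j i≢j
... | tri> _ _ j<i = inj₂ j<i

reflects : (_⊏_ : Rel (Fin k) 0ℓ) → (∀ {i j} → i ≢ j → i ⊏ j ⊎ j ⊏ i) →
           (f : Fin k → Fin m) → (∀ {i j} → i ⊏ j → f i < f j) → ∀ {i j} → f i < f j → i ⊏ j
reflects _⊏_ total f mono {i} {j} fi<fj with i ≟ j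
... | yes refl = contradiction fi<fj (<-irrefl refl)
... | no i≢j with total i≢j
...   | inj₁ i⊏j = i⊏j
...   | inj₂ j⊏i = contradiction (mono j⊏i) (<-asym fi<fj)

-- By the pigeonhole principle some `j ≤ i` has `i ≤ f j`, and `f j ≤ f i` by monotonicity.
mono⇒inflationary : (f : Fin n → Fin n) → (∀ {i j} → i < j → f i < f j) → ∀ i → i ≤ f i
mono⇒inflationary f mono i with injective⇒existsPivot {f = f} injective i
  where
  injective : ∀ {i j} → f i ≡ f j → i ≡ j
  injective {i} {j} e with <-cmp i j
  ... | tri< i<j _ _ = contradiction (mono i<j) (<-irrefl e)
  ... | tri≈ _ i≡j _ = i≡j
  ... | tri> _ _ j<i = contradiction (mono j<i) (<-irrefl (sym e))
... | j , j≤i , i≤fj with <-cmp j i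
...   | tri< j<i _ _ = ≤-trans i≤fj (ℕ.<⇒≤ (mono j<i))
...   | tri≈ _ refl _ = i≤fj
...   | tri> _ _ i<j = contradiction i<j (ℕ.≤⇒≯ j≤i)

-- Both `π` and its inverse are increasing, hence inflationary.
mono⇒id : (π : Perm n) → (∀ {i j} → i < j → π ⟨$⟩ʳ i < π ⟨$⟩ʳ j) → π ≈ id
mono⇒id π mono i = ≤-antisym
  (subst (π ⟨$⟩ʳ i ≤_) (inverseˡ π) (mono⇒inflationary (π ⟨$⟩ˡ_) mono⁻ (π ⟨$⟩ʳ i)))
  (mono⇒inflationary (π ⟨$⟩ʳ_) mono i)
  where
  mono⁻ : ∀ {i j} → i < j → π ⟨$⟩ˡ i < π ⟨$⟩ˡ j
  mono⁻ i<j = reflects _<_ <-total (π ⟨$⟩ʳ_) mono (subst₂ _<_ (sym (inverseʳ π)) (sym (inverseʳ π)) i<j)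

-- Permutations from linear orders

minimum : ∀ {k} {_⊏_ : Rel (Fin (ℕ.suc k)) 0ℓ} → Transitive _⊏_ →
          (∀ {i j} → i ≢ j → i ⊏ j ⊎ j ⊏ i) → Σ[ m ∈ Fin (ℕ.suc k) ] (∀ {j} → j ≢ m → m ⊏ j)
minimum {ℕ.zero} _ _ = zero , λ { {zero} 0≢0 → contradiction refl 0≢0 }
minimum {ℕ.suc k} {_⊏_} tr total
  with minimum {k} {λ i j → suc i ⊏ suc j} tr (λ i≢j → total (i≢j ∘ λ { refl → refl }))
... | m , m-min with total {zero} {suc m} (λ ())
...   | inj₁ 0⊏m = zero , min
  where
  min : ∀ {j} → j ≢ zero → zero ⊏ j
  min {zero} j≢0 = contradiction refl j≢0
  min {suc j} _ with j ≟ m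
  ... | yes refl = 0⊏m
  ... | no j≢m = tr 0⊏m (m-min j≢m)
...   | inj₂ m⊏0 = suc m , min
  where
  min : ∀ {j} → j ≢ suc m → suc m ⊏ j
  min {zero} _ = m⊏0
  min {suc j} j≢m = m-min (j≢m ∘ cong suc)

-- Selection sort: the minimum gets rank 0, and the other elements, reached through `punchIn m`, are
-- ranked recursively above it.
ranking : ∀ {k} {_⊏_ : Rel (Fin k) 0ℓ} → (∀ {i} → ¬ (i ⊏ i)) → Transitive _⊏_ →
          (∀ {i j} → i ≢ j → i ⊏ j ⊎ j ⊏ i) →
          Σ[ u ∈ Perm k ] (∀ {i j} → i ⊏ j → u ⟨$⟩ʳ i < u ⟨$⟩ʳ j)
ranking {ℕ.zero} _ _ _ = id , λ { {()} }
ranking {ℕ.suc k} {_⊏_} irr tr total with minimum tr total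
... | m , m-min with ranking {k} {λ i j → punchIn m i ⊏ punchIn m j} irr tr
                       (λ i≢j → total (i≢j ∘ punchIn-injective m _ _))
...   | π , π-mono = u , mono
  where
  u = insert m zero π

  mono : ∀ {i j} → i ⊏ j → u ⟨$⟩ʳ i < u ⟨$⟩ʳ j
  mono {i} {j} i⊏j with m ≟ i | m ≟ j
  ... | yes refl | yes refl = contradiction i⊏j irr
  ... | no m≢i | yes refl = contradiction (tr i⊏j (m-min (m≢i ∘ sym))) irr
  ... | yes refl | no m≢j = s≤s z≤n
  ... | no m≢i | no m≢j = s≤s (π-mono
          (subst₂ _⊏_ (sym (punchIn-punchOut m≢i)) (sym (punchIn-punchOut m≢j)) i⊏j))

rankingFrom : ∀ t {k} {_⊏_ : Rel (Fin k) 0ℓ} → (∀ {i} → ¬ (i ⊏ i)) → Transitive _⊏_ →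
              (∀ {i j} → i ≢ j → i ⊏ j ⊎ j ⊏ i) →
              Σ[ u ∈ Perm k ] (∀ {i j} → i ⊏ j → u ⟨$⟩ʳ i <[ t ] u ⟨$⟩ʳ j)
rankingFrom ⊕ = ranking
rankingFrom ⊖ irr tr total with ranking irr (flip′ tr) (λ i≢j → total (i≢j ∘ sym))
... | u , mono = u , mono

mono⇒isStandardization : (a : Fin k → Fin m) (u : Perm k) →
  (∀ {i j} → u ⟨$⟩ʳ i < u ⟨$⟩ʳ j → a i < a j) → IsStandardization a u
mono⇒isStandardization a u mono i j =
  mk⇔ mono (reflects (λ i j → u ⟨$⟩ʳ i < u ⟨$⟩ʳ j) (λ i≢j → <-total (i≢j ∘ val-injective u)) a mono)

standardization : (a : Fin k → Fin m) → (∀ {i j} → a i ≡ a j → i ≡ j) → ∃ (IsStandardization a)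
standardization {k} a inj =
  let u , mono = ranking {_⊏_ = _⊏_} (<-irrefl refl) <-trans total in
  u , λ i j → mk⇔ (reflects _⊏_ total (u ⟨$⟩ʳ_) mono) mono
  where
  _⊏_ : Rel (Fin k) 0ℓ
  i ⊏ j = a i < a j

  total : ∀ {i j} → i ≢ j → i ⊏ j ⊎ j ⊏ i
  total i≢j = <-total (i≢j ∘ inj)

-- The weak order

≤ʷ-trans : (x y z : Perm n) → x ≤ʷ y → y ≤ʷ z → x ≤ʷ z
≤ʷ-trans x y z x≤y y≤z a b = y≤z a b ∘ x≤y a b

≤ʷ-reflexive : (x y : Perm n) → x ≈ y → x ≤ʷ y
≤ʷ-reflexive x y e a b (a<b , h) =
  a<b , subst₂ _<_ (≈⇒pos x y e b) (≈⇒pos x y e a) h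

¬Inverted⇒ : ∀ (x : Perm n) {a b} → a < b → ¬ Inverted x a b → pos x a < pos x b
¬Inverted⇒ x a<b ¬inv = ≮∧≢⇒> (λ h → ¬inv (a<b , h)) λ e → <-irrefl (pos-injective x (sym e)) a<b

inverted? : ∀ (x : Perm n) a b → Dec (Inverted x a b)
inverted? x a b = (a Data.Fin.Properties.<? b) ×-dec (pos x b Data.Fin.Properties.<? pos x a)

noninverted-anti : (x y : Perm n) → x ≤ʷ y → ∀ {a b} → a < b → pos y a < pos y b → pos x a < pos x b
noninverted-anti x y x≤y a<b h =
  ¬Inverted⇒ x a<b λ inv → <-asym h (proj₂ (x≤y _ _ inv))

-- Equal inversion sets put any two values in the same order, so sending a position in `x` to the
-- position of its entry in `y` is increasing, hence the identity.
≤ʷ-antisym : (x y : Perm n) → x ≤ʷ y → y ≤ʷ x → x ≈ y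
≤ʷ-antisym x y x≤y y≤x i =
  trans (sym (inverseʳ y)) (cong (y ⟨$⟩ʳ_) (mono⇒id (x ∘ₚ flip y) mono i))
  where
  pos-mono : ∀ {a b} → pos x a < pos x b → pos y a < pos y b
  pos-mono {a} {b} h with <-cmp a b
  ... | tri< a<b _ _ = noninverted-anti y x y≤x a<b h
  ... | tri≈ _ refl _ = contradiction h (<-irrefl refl)
  ... | tri> _ _ b<a = proj₂ (x≤y b a (b<a , h))

  mono : ∀ {i j} → i < j → pos y (x ⟨$⟩ʳ i) < pos y (x ⟨$⟩ʳ j)
  mono i<j = pos-mono (subst₂ _<_ (sym (inverseˡ x)) (sym (inverseˡ x)) i<j)

-- The congruence given by extremal pairs

-- For s = t = ⊕: every b with a < b ≤ d stands to the left of a.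
Extreme : Sign → Sign → Perm n → Fin n → Fin n → Set
Extreme s t x a d = ∀ b → a <[ s ] b → ¬ (d <[ s ] b) → pos x b <[ t ] pos x a

ExtremeIncl : Sign → Sign → Rel (Perm n) 0ℓ
ExtremeIncl s t x y = ∀ a d → Extreme s t x a d → Extreme s t y a d

infix 4 _≡ᵗᴮ_
-- Signs (⊕ , ⊕) and (⊖ , ⊖) give the sets S and T, made of inversions; mixed signs give their
-- mirror images, made of noninversions. Meets are handled by the first two kinds, joins by the
-- other two.
_≡ᵗᴮ_ : Rel (Perm n) 0ℓ
x ≡ᵗᴮ y = ∀ s t → ExtremeIncl s t x y × ExtremeIncl s t y x

≡ᵗᴮ-sym : (x y : Perm n) → x ≡ᵗᴮ y → y ≡ᵗᴮ x
≡ᵗᴮ-sym x y h s t = proj₂ (h s t) , proj₁ (h s t)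

≡ᵗᴮ-trans : (x y z : Perm n) → x ≡ᵗᴮ y → y ≡ᵗᴮ z → x ≡ᵗᴮ z
≡ᵗᴮ-trans x y z h k s t =
  (λ a d → proj₁ (k s t) a d ∘ proj₁ (h s t) a d) ,
  (λ a d → proj₂ (h s t) a d ∘ proj₂ (k s t) a d)

≡ᵗᴮ-reflexive : (x y : Perm n) → x ≈ y → x ≡ᵗᴮ y
≡ᵗᴮ-reflexive x y e s t =
  (λ a d E b a<b b≤d → subst₂ _<[ t ]_ (≈⇒pos x y e b) (≈⇒pos x y e a) (E b a<b b≤d)) ,
  (λ a d E b a<b b≤d → subst₂ _<[ t ]_ (sym (≈⇒pos x y e b)) (sym (≈⇒pos x y e a)) (E b a<b b≤d))

module _ (s : Sign) where
  private module S {n} = Ord {n} s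

  ≮-<-trans : {a b c : Fin n} → ¬ (b <[ s ] a) → b <[ s ] c → a <[ s ] c
  ≮-<-trans {a = a} {b} b≮a b<c with S.compare a b
  ... | tri< a<b _ _ = S.trans a<b b<c
  ... | tri≈ _ refl _ = b<c
  ... | tri> _ _ b<a = contradiction b<a b≮a

  ≮-refl : {a : Fin n} → ¬ (a <[ s ] a)
  ≮-refl = S.irrefl refl

module _ (s t : Sign) where
  private
    module S {n} = Ord {n} s
    module T {n} = Ord {n} t

  extreme? : ∀ (x : Perm n) a d → Dec (Extreme s t x a d)
  extreme? x a d = all? λ b → (a S.<? b) →-dec (¬? (d S.<? b) →-dec (pos x b T.<? pos x a))

  extreme-prefix : ∀ (x : Perm n) {a b d} → Extreme s t x a d → ¬ (d <[ s ] b) → Extreme s t x a b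
  extreme-prefix x E b≤d c a<c c≤b = E c a<c λ d<c → c≤b (≮-<-trans s b≤d d<c)

  extreme-trans : ∀ (x : Perm n) {a b d} → a <[ s ] b →
                  Extreme s t x a b → Extreme s t x b d → Extreme s t x a d
  extreme-trans x {b = b} a<b E F c a<c c≤d with b S.<? c
  ... | yes b<c = T.trans (F c b<c c≤d) (E b a<b (≮-refl s))
  ... | no b≮c = E c a<c b≮c

  -- A value b for which the conclusion fails, nearest to d, would make (b , d)
  -- an extremal pair of y, hence of x, which contradicts that of d and a in x.
  extreme-opposite : ∀ (x y : Perm n) → ExtremeIncl s t y x → ExtremeIncl (opposite s) t x y
  extreme-opposite x y y⊆x d a E b d<b b≤a =
    go b (spo-noetherian S.isStrictPartialOrder b) (<[]-opposite s d<b)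
      (b≤a ∘ <[]-opposite⁻ s)
    where
    go : ∀ b → Acc (flip′ _<[ s ]_) b → b <[ s ] d → ¬ (b <[ s ] a) → pos y b <[ t ] pos y d
    go b (acc rec) b<d a≤b with T.compare (pos y b) (pos y d)
    ... | tri< h _ _ = h
    ... | tri≈ _ e _ = contradiction b<d (S.irrefl (pos-injective y e))
    ... | tri> _ _ d<b = contradiction
            (y⊆x b d Eb d b<d (≮-refl s))
            (T.asym (E b (<[]-opposite⁻ s b<d) (a≤b ∘ <[]-opposite s)))
      where
      Eb : Extreme s t y b d
      Eb c b<c c≤d with S.compare c d
      ... | tri< c<d _ _ = T.trans (go c (rec b<c) c<d λ c<a → a≤b (S.trans b<c c<a)) d<b
      ... | tri≈ _ refl _ = d<b
      ... | tri> _ _ d<c = contradiction d<c c≤d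

-- For each position direction t, one of the two value directions suffices.
≡ᵗᴮ-from : (f : Sign → Sign) → (x y : Perm n) →
           (∀ t → ExtremeIncl (f t) t x y × ExtremeIncl (f t) t y x) → x ≡ᵗᴮ y
≡ᵗᴮ-from f x y h s t with f t | h t
≡ᵗᴮ-from f x y h ⊕ t | ⊕ | g = g
≡ᵗᴮ-from f x y h ⊖ t | ⊖ | g = g
≡ᵗᴮ-from f x y h ⊖ t | ⊕ | g = extreme-opposite ⊕ t x y (proj₂ g) , extreme-opposite ⊕ t y x (proj₁ g)
≡ᵗᴮ-from f x y h ⊕ t | ⊖ | g = extreme-opposite ⊖ t x y (proj₂ g) , extreme-opposite ⊖ t y x (proj₁ g)

-- The weak order for t ≡ s, and its dual for t ≡ opposite s
Weak : Sign → Sign → Rel (Perm n) 0ℓ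
Weak s t x y = ∀ a b → a <[ s ] b → pos x b <[ t ] pos x a → pos y b <[ t ] pos y a

≤ʷ⇒Weak : ∀ s (x y : Perm n) → x ≤ʷ y → Weak s s x y
≤ʷ⇒Weak ⊕ x y x≤y a b a<b h = proj₂ (x≤y a b (a<b , h))
≤ʷ⇒Weak ⊖ x y x≤y a b a<b h = proj₂ (x≤y b a (a<b , h))

Weak⇒≤ʷ : ∀ s (x y : Perm n) → Weak s s x y → x ≤ʷ y
Weak⇒≤ʷ ⊕ x y w a b (a<b , h) = a<b , w a b a<b h
Weak⇒≤ʷ ⊖ x y w a b (a<b , h) = a<b , w b a a<b h

≥ʷ⇒Weak : ∀ t (x y : Perm n) → y ≤ʷ x → Weak (opposite t) t x y
≥ʷ⇒Weak ⊕ x y y≤x a b b<a h = noninverted-anti y x y≤x b<a h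
≥ʷ⇒Weak ⊖ x y y≤x a b a<b h = noninverted-anti y x y≤x a<b h

Weak⇒≥ʷ : ∀ t (x y : Perm n) → Weak (opposite t) t x y → y ≤ʷ x
Weak⇒≥ʷ ⊕ x y w b a (b<a , h) =
  b<a , ≮∧≢⇒> (λ g → <-asym h (w a b b<a g)) (λ e → <-irrefl (pos-injective x e) b<a)
Weak⇒≥ʷ ⊖ x y w a b (a<b , h) =
  a<b , ≮∧≢⇒> (λ g → <-asym h (w a b a<b g)) (λ e → <-irrefl (pos-injective x e) a<b)

Weak⇒ExtremeIncl : ∀ s t (x y : Perm n) → Weak s t x y → ExtremeIncl s t x y
Weak⇒ExtremeIncl s t x y w a d E b a<b b≤d = w a b a<b (E b a<b b≤d)

-- Compatibility with meets and joins

module _ (s t : Sign) where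
  private
    module S {n} = Ord {n} s
    module T {n} = Ord {n} t

  -- The common extremal pairs of x and y are the inversions of a permutation
  -- below both.
  extremeBound : ∀ (x y : Perm n) → ∃[ z ] (Weak s t z x × Weak s t z y ×
    (∀ a d → Extreme s t x a d → Extreme s t y a d → Extreme s t z a d))
  extremeBound {n} x y = z , below x proj₁ , below y proj₂ , extreme
    where
    I : Fin n → Fin n → Set
    I a d = Extreme s t x a d × Extreme s t y a d

    I? : ∀ a d → Dec (I a d)
    I? a d = extreme? s t x a d ×-dec extreme? s t y a d

    prefix : ∀ {a b d} → I a d → ¬ (d <[ s ] b) → I a b
    prefix (E , F) b≤d = extreme-prefix s t x E b≤d , extreme-prefix s t y F b≤d

    I-trans : ∀ {a b d} → a <[ s ] b → I a b → I b d → I a d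
    I-trans a<b (E , F) (E′ , F′) = extreme-trans s t x a<b E E′ , extreme-trans s t y a<b F F′

    -- The order in which `z` is to list the values: exactly the pairs in `I` are reversed with
    -- respect to `s`.
    _⊏_ : Rel (Fin n) 0ℓ
    a ⊏ b = (a <[ s ] b × ¬ I a b) ⊎ (b <[ s ] a × I b a)

    irr : ∀ {a} → ¬ (a ⊏ a)
    irr (inj₁ (a<a , _)) = ≮-refl s a<a
    irr (inj₂ (a<a , _)) = ≮-refl s a<a

    -- Each case comes down to transitivity of `I` and to `prefix`, which makes the complement of
    -- `I` transitive as well.
    tr : Transitive _⊏_
    tr (inj₁ (a<b , ¬Iab)) (inj₁ (b<c , _)) =
      inj₁ (S.trans a<b b<c , λ Iac → ¬Iab (prefix Iac (S.asym b<c)))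
    tr {a} {b} {c} (inj₁ (a<b , ¬Iab)) (inj₂ (c<b , Icb)) with S.compare a c
    ... | tri< a<c _ _ = inj₁ (a<c , λ Iac → ¬Iab (I-trans a<c Iac Icb))
    ... | tri≈ _ refl _ = contradiction Icb ¬Iab
    ... | tri> _ _ c<a = inj₂ (c<a , prefix Icb (S.asym a<b))
    tr {a} {b} {c} (inj₂ (b<a , Iba)) (inj₁ (b<c , ¬Ibc)) with S.compare a c
    ... | tri< a<c _ _ = inj₁ (a<c , λ Iac → ¬Ibc (I-trans b<a Iba Iac))
    ... | tri≈ _ refl _ = contradiction Iba ¬Ibc
    ... | tri> _ _ c<a = contradiction (prefix Iba (S.asym c<a)) ¬Ibc
    tr (inj₂ (b<a , Iba)) (inj₂ (c<b , Icb)) =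
      inj₂ (S.trans c<b b<a , I-trans c<b Icb Iba)

    total : ∀ {a b} → a ≢ b → a ⊏ b ⊎ b ⊏ a
    total {a} {b} a≢b with S.compare a b
    ... | tri≈ _ a≡b _ = contradiction a≡b a≢b
    ... | tri< a<b _ _ with I? a b
    ...   | yes Iab = inj₂ (inj₂ (a<b , Iab))
    ...   | no ¬Iab = inj₁ (inj₁ (a<b , ¬Iab))
    total {a} {b} a≢b | tri> _ _ b<a with I? b a
    ...   | yes Iba = inj₁ (inj₂ (b<a , Iba))
    ...   | no ¬Iba = inj₂ (inj₁ (b<a , ¬Iba))

    z : Perm n
    z = flip (proj₁ (rankingFrom t irr tr total))

    mono : ∀ {a b} → a ⊏ b → pos z a <[ t ] pos z b
    mono = proj₂ (rankingFrom t irr tr total)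

    below : ∀ w → (∀ {a b} → I a b → Extreme s t w a b) → Weak s t z w
    below w E a b a<b h with I? a b
    ... | yes Iab = E Iab b a<b (≮-refl s)
    ... | no ¬Iab = contradiction h (T.asym (mono (inj₁ (a<b , ¬Iab))))

    extreme : ∀ a d → Extreme s t x a d → Extreme s t y a d → Extreme s t z a d
    extreme a d E F b a<b b≤d = mono (inj₂ (a<b , prefix (E , F) b≤d))

  -- For equal signs this is a meet in the weak order, for opposite signs a join.
  IsWeakMeet : Perm n → Perm n → Perm n → Set
  IsWeakMeet x y m = Weak s t m x × Weak s t m y × (∀ z → Weak s t z x → Weak s t z y → Weak s t z m)

  -- An extremal pair of `m` is one of `x` and of `y`, hence of `x′` and of `y′`, hence of their
  -- bound `z` from `extremeBound`. As `z` lies below `m′`, it is one of `m′`.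
  weakMeet-cong : ∀ (x x′ y y′ m m′ : Perm n) → IsWeakMeet x y m → IsWeakMeet x′ y′ m′ →
                  ExtremeIncl s t x x′ → ExtremeIncl s t y y′ → ExtremeIncl s t m m′
  weakMeet-cong x x′ y y′ m m′ (m≤x , m≤y , _) (_ , _ , glb) x⊆x′ y⊆y′ a d E =
    let z , z≤x′ , z≤y′ , bound = extremeBound x′ y′ in
    Weak⇒ExtremeIncl s t z m′ (glb z z≤x′ z≤y′) a d
      (bound a d (x⊆x′ a d (Weak⇒ExtremeIncl s t m x m≤x a d E))
                 (y⊆y′ a d (Weak⇒ExtremeIncl s t m y m≤y a d E)))

isMeet⇒isWeakMeet : ∀ t (x y m : Perm n) → IsMeet x y m → IsWeakMeet t t x y m
isMeet⇒isWeakMeet t x y m (m≤x , m≤y , glb) =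
  ≤ʷ⇒Weak t m x m≤x , ≤ʷ⇒Weak t m y m≤y ,
  λ z z≤x z≤y → ≤ʷ⇒Weak t z m (glb z (Weak⇒≤ʷ t z x z≤x) (Weak⇒≤ʷ t z y z≤y))

isJoin⇒isWeakMeet : ∀ t (x y j : Perm n) → IsJoin x y j → IsWeakMeet (opposite t) t x y j
isJoin⇒isWeakMeet t x y j (x≤j , y≤j , lub) =
  ≥ʷ⇒Weak t j x x≤j , ≥ʷ⇒Weak t j y y≤j ,
  λ z z≥x z≥y → ≥ʷ⇒Weak t z j (lub z (Weak⇒≥ʷ t z x z≥x) (Weak⇒≥ʷ t z y z≥y))

≡ᵗᴮ-isLatticeCongruence : ∀ n → IsLatticeCongruence (_≡ᵗᴮ_ {n})
≡ᵗᴮ-isLatticeCongruence n = record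
  { isEquivalence = record
    { refl  = λ {x} → ≡ᵗᴮ-reflexive x x (λ _ → refl)
    ; sym   = λ {x} {y} → ≡ᵗᴮ-sym x y
    ; trans = λ {x} {y} {z} → ≡ᵗᴮ-trans x y z
    }
  ; reflexive = λ {x} {y} → ≡ᵗᴮ-reflexive x y
  -- Joins are meets for the mixed signs; `≡ᵗᴮ-from` then recovers the kinds with equal signs.
  ; ∨-cong = λ {x} {x′} {y} {y′} {j} {j′} isJ isJ′ h k → ≡ᵗᴮ-from opposite j j′ λ t →
      weakMeet-cong (opposite t) t x x′ y y′ j j′
        (isJoin⇒isWeakMeet t x y j isJ) (isJoin⇒isWeakMeet t x′ y′ j′ isJ′)
        (proj₁ (h (opposite t) t)) (proj₁ (k (opposite t) t)) ,
      weakMeet-cong (opposite t) t x′ x y′ y j′ j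
        (isJoin⇒isWeakMeet t x′ y′ j′ isJ′) (isJoin⇒isWeakMeet t x y j isJ)
        (proj₂ (h (opposite t) t)) (proj₂ (k (opposite t) t))
  ; ∧-cong = λ {x} {x′} {y} {y′} {m} {m′} isM isM′ h k → ≡ᵗᴮ-from (λ t → t) m m′ λ t →
      weakMeet-cong t t x x′ y y′ m m′
        (isMeet⇒isWeakMeet t x y m isM) (isMeet⇒isWeakMeet t x′ y′ m′ isM′)
        (proj₁ (h t t)) (proj₁ (k t t)) ,
      weakMeet-cong t t x′ x y′ y m′ m
        (isMeet⇒isWeakMeet t x′ y′ m′ isM′) (isMeet⇒isWeakMeet t x y m isM)
        (proj₂ (h t t)) (proj₂ (k t t))
  }

-- Concatenation and insertion

-- A view in place of `splitAt`: matching on it rewrites the index itself as `i ↑ˡ q` or `p ↑ʳ j`.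
data Block {p q} : Fin (p ℕ.+ q) → Set where
  inLeft  : ∀ i → Block (i ↑ˡ q)
  inRight : ∀ j → Block (p ↑ʳ j)

block : ∀ p {q} (c : Fin (p ℕ.+ q)) → Block {p} {q} c
block ℕ.zero c = inRight c
block (ℕ.suc p) zero = inLeft zero
block (ℕ.suc p) (suc c) with block p c
... | inLeft i  = inLeft (suc i)
... | inRight j = inRight j

↑ˡ-mono-< : ∀ q {i j : Fin p} → i < j → i ↑ˡ q < j ↑ˡ q
↑ˡ-mono-< q {i} {j} = subst₂ ℕ._<_ (sym (toℕ-↑ˡ i q)) (sym (toℕ-↑ˡ j q))

↑ʳ-mono-< : ∀ p {i j : Fin q} → i < j → p ↑ʳ i < p ↑ʳ j
↑ʳ-mono-< p {i} {j} i<j =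
  subst₂ ℕ._<_ (sym (toℕ-↑ʳ p i)) (sym (toℕ-↑ʳ p j)) (ℕ.+-monoʳ-< p i<j)

↑ˡ<↑ʳ : ∀ (i : Fin p) (j : Fin q) → i ↑ˡ q < p ↑ʳ j
↑ˡ<↑ʳ {p} {q} i j = subst₂ ℕ._<_ (sym (toℕ-↑ˡ i q)) (sym (toℕ-↑ʳ p j))
  (ℕ.<-≤-trans (toℕ<n i) (ℕ.m≤m+n p (toℕ j)))

↑ˡ≢↑ʳ : ∀ (i : Fin p) (j : Fin q) → i ↑ˡ q ≢ p ↑ʳ j
↑ˡ≢↑ʳ i j e = <-irrefl e (↑ˡ<↑ʳ i j)

-- `f` and `g` list the same set of values, so a common value has the same rank in both. With `σ`
-- matching the indices of equal values, `u` inverse, then `σ`, then `u′` is increasing, hence the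
-- identity.
standardization-unique : ∀ {f g : Fin p → Fin m} (u u′ : Perm p) →
  (∀ {i j} → f i ≡ f j → i ≡ j) → (∀ {i j} → g i ≡ g j → i ≡ j) →
  IsStandardization f u → IsStandardization g u′ →
  (∀ i → ∃[ j ] g j ≡ f i) → (∀ j → ∃[ i ] f i ≡ g j) →
  ∀ {i j} → f i ≡ g j → u ⟨$⟩ʳ i ≡ u′ ⟨$⟩ʳ j
standardization-unique {p} {f = f} {g} u u′ f-inj g-inj st st′ f⊆g g⊆f {i} {j} e =
  sym (trans (cong (u′ ⟨$⟩ʳ_) (g-inj (trans (sym e)
                (trans (sym (proj₂ (f⊆g i))) (cong (λ l → g (proj₁ (f⊆g l))) (sym (inverseˡ u)))))))
             (mono⇒id π mono (u ⟨$⟩ʳ i)))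
  where
  σ : Perm p
  σ = permutation (proj₁ ∘ f⊆g) (proj₁ ∘ g⊆f)
    (λ j → g-inj (trans (proj₂ (f⊆g _)) (proj₂ (g⊆f j))))
    (λ i → f-inj (trans (proj₂ (g⊆f _)) (proj₂ (f⊆g i))))

  π : Perm p
  π = flip u ∘ₚ (σ ∘ₚ u′)

  mono : ∀ {c d} → c < d → π ⟨$⟩ʳ c < π ⟨$⟩ʳ d
  mono {c} {d} c<d = Equivalence.from (st′ _ _)
    (subst₂ _<_ (sym (proj₂ (f⊆g _))) (sym (proj₂ (f⊆g _)))
      (Equivalence.to (st _ _) (subst₂ _<_ (sym (inverseʳ u)) (sym (inverseʳ u)) c<d)))

-- Extremality in `x` restricts to the values of the subword, so it passes to `u`, from there to
-- `u′`, and its instance at the far end is read off in `x′`. The two subwords occupy the same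
-- positions and have the same values.
subword-extreme : ∀ s t (ι : Fin p → Fin n) → (∀ {i j} → i < j → ι i < ι j) →
  ∀ (x x′ : Perm n) (u u′ : Perm p) →
  IsStandardization (λ i → x ⟨$⟩ʳ ι i) u → IsStandardization (λ i → x′ ⟨$⟩ʳ ι i) u′ →
  (∀ i → ∃[ j ] x′ ⟨$⟩ʳ ι j ≡ x ⟨$⟩ʳ ι i) → (∀ j → ∃[ i ] x ⟨$⟩ʳ ι i ≡ x′ ⟨$⟩ʳ ι j) →
  ExtremeIncl s t u u′ → ∀ i j → x ⟨$⟩ʳ ι i <[ s ] x ⟨$⟩ʳ ι j →
  Extreme s t x (x ⟨$⟩ʳ ι i) (x ⟨$⟩ʳ ι j) → pos x′ (x ⟨$⟩ʳ ι j) <[ t ] pos x′ (x ⟨$⟩ʳ ι i)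
subword-extreme {p = p} s t ι ι-mono x x′ u u′ st st′ f⊆g g⊆f u⊆u′ i j i<j E
  with f⊆g i | f⊆g j
... | i′ , eᵢ | j′ , eⱼ =
  subst₂ _<[ t ]_ (sym (posx′ eⱼ)) (sym (posx′ eᵢ))
    (<[]-map t ι-mono ι-mono
      (subst₂ _<[ t ]_ (trans (cong (pos u′) (rank (sym eⱼ))) (inverseˡ u′))
                       (trans (cong (pos u′) (rank (sym eᵢ))) (inverseˡ u′))
        (u⊆u′ _ _ Eu (u ⟨$⟩ʳ j)
          (<[]-map s (Equivalence.from (st i j)) (Equivalence.from (st j i)) i<j) (≮-refl s))))
  where
  ι-inj : ∀ {i j} → ι i ≡ ι j → i ≡ j
  ι-inj {i} {j} e with i ≟ j
  ... | yes i≡j = i≡j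
  ... | no i≢j with <-total i≢j
  ...   | inj₁ i<j = contradiction (ι-mono i<j) (<-irrefl e)
  ...   | inj₂ j<i = contradiction (ι-mono j<i) (<-irrefl (sym e))

  posx′ : ∀ {i i′} → x′ ⟨$⟩ʳ ι i′ ≡ x ⟨$⟩ʳ ι i → pos x′ (x ⟨$⟩ʳ ι i) ≡ ι i′
  posx′ e = trans (cong (pos x′) (sym e)) (inverseˡ x′)

  rank : ∀ {i i′} → x ⟨$⟩ʳ ι i ≡ x′ ⟨$⟩ʳ ι i′ → u ⟨$⟩ʳ i ≡ u′ ⟨$⟩ʳ i′
  rank = standardization-unique u u′ (ι-inj ∘ val-injective x) (ι-inj ∘ val-injective x′)
    st st′ f⊆g g⊆f

  Eu : Extreme s t u (u ⟨$⟩ʳ i) (u ⟨$⟩ʳ j)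
  Eu c i<c c≤j = subst (pos u c <[ t ]_) (sym (inverseˡ u))
    (<[]-map t (reflects _<_ <-total ι ι-mono) (reflects _<_ <-total ι ι-mono)
      (subst₂ _<[ t ]_ (inverseˡ x) (inverseˡ x) (E (x ⟨$⟩ʳ ι l) i<l l≤j)))
    where
    l : Fin p
    l = pos u c

    i<l : x ⟨$⟩ʳ ι i <[ s ] x ⟨$⟩ʳ ι l
    i<l = <[]-map s (Equivalence.to (st i l)) (Equivalence.to (st l i))
            (subst (u ⟨$⟩ʳ i <[ s ]_) (sym (inverseʳ u)) i<c)

    l≤j : ¬ (x ⟨$⟩ʳ ι j <[ s ] x ⟨$⟩ʳ ι l)
    l≤j h = c≤j (subst (u ⟨$⟩ʳ j <[ s ]_) (inverseʳ u)
              (<[]-map s (Equivalence.from (st j l)) (Equivalence.from (st l j)) h))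

module _ {p q} (x x′ : Perm (p ℕ.+ q)) where
  LeftIncl : Set
  LeftIncl = ∀ i → ∃[ j ] x′ ⟨$⟩ʳ (j ↑ˡ q) ≡ x ⟨$⟩ʳ (i ↑ˡ q)

  RightIncl : Set
  RightIncl = ∀ i → ∃[ j ] x′ ⟨$⟩ʳ (p ↑ʳ j) ≡ x ⟨$⟩ʳ (p ↑ʳ i)

leftIncl⇒rightIncl : ∀ {p q} (x x′ : Perm (p ℕ.+ q)) → LeftIncl x x′ → RightIncl x′ x
leftIncl⇒rightIncl {p} {q} x x′ h i = from (block p (pos x a)) (inverseʳ x)
  where
  a = x′ ⟨$⟩ʳ (p ↑ʳ i)

  from : ∀ {c} → Block c → x ⟨$⟩ʳ c ≡ a → ∃[ j ] x ⟨$⟩ʳ (p ↑ʳ j) ≡ a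
  from (inRight j) e = j , e
  from (inLeft j) e =
    let j′ , e′ = h j in contradiction (val-injective x′ (trans e′ e)) (↑ˡ≢↑ʳ j′ i)

-- Two values in the same block are compared inside that subword. For values in different blocks the
-- order of the blocks decides, and it is the same in `x` and `x′`.
blocks-extreme : ∀ {p q} s t (x x′ : Perm (p ℕ.+ q)) (u u′ : Perm p) (v v′ : Perm q) →
  LeftIncl x x′ → LeftIncl x′ x →
  IsStandardization (λ i → x ⟨$⟩ʳ (i ↑ˡ q)) u → IsStandardization (λ i → x′ ⟨$⟩ʳ (i ↑ˡ q)) u′ →
  IsStandardization (λ j → x ⟨$⟩ʳ (p ↑ʳ j)) v → IsStandardization (λ j → x′ ⟨$⟩ʳ (p ↑ʳ j)) v′ →
  ExtremeIncl s t u u′ → ExtremeIncl s t v v′ → ExtremeIncl s t x x′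
blocks-extreme {p} {q} s t x x′ u u′ v v′ x⊆x′ x′⊆x stu stu′ stv stv′ u⊆u′ v⊆v′ a d E b a<b b≤d =
  go (block p (pos x a)) (block p (pos x b)) refl refl
  where
  right : RightIncl x x′
  right = leftIncl⇒rightIncl x′ x x′⊆x

  right′ : RightIncl x′ x
  right′ = leftIncl⇒rightIncl x x′ x⊆x′

  Eb : Extreme s t x a b
  Eb = extreme-prefix s t x E b≤d

  result : ∀ i j → x ⟨$⟩ʳ i ≡ a → x ⟨$⟩ʳ j ≡ b →
    (x ⟨$⟩ʳ i <[ s ] x ⟨$⟩ʳ j → Extreme s t x (x ⟨$⟩ʳ i) (x ⟨$⟩ʳ j) →
      pos x′ (x ⟨$⟩ʳ j) <[ t ] pos x′ (x ⟨$⟩ʳ i)) → pos x′ b <[ t ] pos x′ a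
  result i j refl refl h = h a<b Eb

  pos≡ : ∀ {i c} → pos x c ≡ i → x ⟨$⟩ʳ i ≡ c
  pos≡ refl = inverseʳ x

  pos′≡ : ∀ {i i′ c} → pos x c ≡ i → x′ ⟨$⟩ʳ i′ ≡ x ⟨$⟩ʳ i → pos x′ c ≡ i′
  pos′≡ e e′ = trans (cong (pos x′) (sym (trans e′ (pos≡ e)))) (inverseˡ x′)

  go : ∀ {i j} → Block i → Block j → pos x a ≡ i → pos x b ≡ j → pos x′ b <[ t ] pos x′ a
  go (inLeft i) (inLeft j) eₐ e_b = result _ _ (pos≡ eₐ) (pos≡ e_b)
    (subword-extreme s t (_↑ˡ q) (↑ˡ-mono-< q) x x′ u u′ stu stu′ x⊆x′ x′⊆x u⊆u′ i j)
  go (inRight i) (inRight j) eₐ e_b = result _ _ (pos≡ eₐ) (pos≡ e_b)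
    (subword-extreme s t (p ↑ʳ_) (↑ʳ-mono-< p) x x′ v v′ stv stv′ right right′ v⊆v′ i j)
  go (inLeft i) (inRight j) eₐ e_b =
    let i′ , eᵢ = x⊆x′ i ; j′ , eⱼ = right j in
    subst₂ _<[ t ]_ (sym (pos′≡ e_b eⱼ)) (sym (pos′≡ eₐ eᵢ))
      (<[]-map t (λ h → contradiction h (<-asym (↑ˡ<↑ʳ i j))) (λ _ → ↑ˡ<↑ʳ i′ j′)
        (subst₂ _<[ t ]_ e_b eₐ (Eb b a<b (≮-refl s))))
  go (inRight i) (inLeft j) eₐ e_b =
    let i′ , eᵢ = right i ; j′ , eⱼ = x⊆x′ j in
    subst₂ _<[ t ]_ (sym (pos′≡ e_b eⱼ)) (sym (pos′≡ eₐ eᵢ))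
      (<[]-map t (λ _ → ↑ˡ<↑ʳ j′ i′) (λ h → contradiction h (<-asym (↑ˡ<↑ʳ j i)))
        (subst₂ _<[ t ]_ e_b eₐ (Eb b a<b (≮-refl s))))

≡ᵗᴮ-insertional : Insertional (λ n → _≡ᵗᴮ_ {n})
≡ᵗᴮ-insertional Q _ {u} {u′} {v} {v′} {x} {x′} φ φ′ h k s t =
  blocks-extreme s t x x′ u u′ v v′ x⊆x′ x′⊆x φ.left φ′.left φ.right φ′.right
    (proj₁ (h s t)) (proj₁ (k s t)) ,
  blocks-extreme s t x′ x u′ u v′ v x′⊆x x⊆x′ φ′.left φ.left φ′.right φ.right
    (proj₂ (h s t)) (proj₂ (k s t))
  where
  module φ = Isφ φ
  module φ′ = Isφ φ′

  x⊆x′ : LeftIncl x x′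
  x⊆x′ i = Equivalence.to (φ′.values _) (Equivalence.from (φ.values _) (i , refl))

  x′⊆x : LeftIncl x′ x
  x′⊆x i = Equivalence.to (φ.values _) (Equivalence.from (φ′.values _) (i , refl))

module _ {p q} (u : Perm p) (v : Perm q) where
  ×ₚ-↑ˡ : ∀ i → (u ×ₚ v) ⟨$⟩ʳ (i ↑ˡ q) ≡ (u ⟨$⟩ʳ i) ↑ˡ q
  ×ₚ-↑ˡ i rewrite splitAt-↑ˡ p i q = refl

  ×ₚ-↑ʳ : ∀ j → (u ×ₚ v) ⟨$⟩ʳ (p ↑ʳ j) ≡ p ↑ʳ (v ⟨$⟩ʳ j)
  ×ₚ-↑ʳ j rewrite splitAt-↑ʳ p q j = refl

  ×ₚ-pos-↑ˡ : ∀ a → pos (u ×ₚ v) (a ↑ˡ q) ≡ pos u a ↑ˡ q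
  ×ₚ-pos-↑ˡ a rewrite splitAt-↑ˡ p a q = refl

  ×ₚ-pos-↑ʳ : ∀ b → pos (u ×ₚ v) (p ↑ʳ b) ≡ p ↑ʳ pos v b
  ×ₚ-pos-↑ʳ b rewrite splitAt-↑ʳ p q b = refl

  ×ₚ-left : IsStandardization (λ i → (u ×ₚ v) ⟨$⟩ʳ (i ↑ˡ q)) u
  ×ₚ-left = mono⇒isStandardization _ u λ {i} {j} h →
    subst₂ _<_ (sym (×ₚ-↑ˡ i)) (sym (×ₚ-↑ˡ j)) (↑ˡ-mono-< q h)

  ×ₚ-right : IsStandardization (λ j → (u ×ₚ v) ⟨$⟩ʳ (p ↑ʳ j)) v
  ×ₚ-right = mono⇒isStandardization _ v λ {i} {j} h →
    subst₂ _<_ (sym (×ₚ-↑ʳ i)) (sym (×ₚ-↑ʳ j)) (↑ʳ-mono-< p h)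

module _ (f : Fin p → Fin n) (f-mono : ∀ {i j} → i < j → f i < f j) (x : Perm n) (u : Perm p)
         (pos-f : ∀ a → pos x (f a) ≡ f (pos u a)) (s t : Sign) where
  private
    f-reflects : ∀ {i j} → f i < f j → i < j
    f-reflects = reflects _<_ <-total f f-mono

  -- Extremality in `x` speaks of every value from `f a` to `f d`, so these must all come from `u`.
  -- In a product they do, because the values of each factor form an interval.
  extreme-image⁺ : ∀ {a d} → (∀ {c} → f a <[ s ] c → ¬ (f d <[ s ] c) → ∃[ b ] f b ≡ c) →
                   Extreme s t u a d → Extreme s t x (f a) (f d)
  extreme-image⁺ {a} convex E c a<c c≤d with convex a<c c≤d
  ... | b , refl = subst₂ _<[ t ]_ (sym (pos-f b)) (sym (pos-f a))
    (<[]-map t f-mono f-mono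
      (E b (<[]-map s f-reflects f-reflects a<c) (c≤d ∘ <[]-map s f-mono f-mono)))

  extreme-image⁻ : ∀ {a d} → Extreme s t x (f a) (f d) → Extreme s t u a d
  extreme-image⁻ {a} E b a<b b≤d = <[]-map t f-reflects f-reflects
    (subst₂ _<[ t ]_ (pos-f b) (pos-f a)
      (E (f b) (<[]-map s f-mono f-mono a<b) (b≤d ∘ <[]-map s f-reflects f-reflects)))

↑ˡ-convex : ∀ s {a d : Fin p} {c : Fin (p ℕ.+ q)} → (a ↑ˡ q) <[ s ] c → ¬ ((d ↑ˡ q) <[ s ] c) →
            ∃[ b ] b ↑ˡ q ≡ c
↑ˡ-convex {p} {q} s {a} {d} {c} = go (block p c)
  where
  go : ∀ {c} → Block c → (a ↑ˡ q) <[ s ] c → ¬ ((d ↑ˡ q) <[ s ] c) → ∃[ b ] b ↑ˡ q ≡ c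
  go (inLeft b) _ _ = b , refl
  go (inRight b) a<b b≤d = contradiction
    (<[]-map s (λ _ → ↑ˡ<↑ʳ d b) (λ h → contradiction h (<-asym (↑ˡ<↑ʳ a b))) a<b) b≤d

↑ʳ-convex : ∀ s {a d : Fin q} {c : Fin (p ℕ.+ q)} → (p ↑ʳ a) <[ s ] c → ¬ ((p ↑ʳ d) <[ s ] c) →
            ∃[ b ] p ↑ʳ b ≡ c
↑ʳ-convex {q} {p} s {a} {d} {c} = go (block p c)
  where
  go : ∀ {c} → Block c → (p ↑ʳ a) <[ s ] c → ¬ ((p ↑ʳ d) <[ s ] c) → ∃[ b ] p ↑ʳ b ≡ c
  go (inRight b) _ _ = b , refl
  go (inLeft b) a<b b≤d = contradiction
    (<[]-map s (λ h → contradiction h (<-asym (↑ˡ<↑ʳ b a))) (λ _ → ↑ˡ<↑ʳ b d) a<b) b≤d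

×ₚ-leftIncl : ∀ (u u′ : Perm p) (v v′ : Perm q) → LeftIncl (u ×ₚ v) (u′ ×ₚ v′)
×ₚ-leftIncl {q = q} u u′ v v′ i = pos u′ (u ⟨$⟩ʳ i) ,
  trans (×ₚ-↑ˡ u′ v′ _) (trans (cong (_↑ˡ q) (inverseʳ u′)) (sym (×ₚ-↑ˡ u v i)))

×ₚ-extreme : ∀ s t (u u′ : Perm p) (v v′ : Perm q) →
  ExtremeIncl s t u u′ → ExtremeIncl s t v v′ → ExtremeIncl s t (u ×ₚ v) (u′ ×ₚ v′)
×ₚ-extreme s t u u′ v v′ = blocks-extreme s t (u ×ₚ v) (u′ ×ₚ v′) u u′ v v′
  (×ₚ-leftIncl u u′ v v′) (×ₚ-leftIncl u′ u v′ v)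
  (×ₚ-left u v) (×ₚ-left u′ v′) (×ₚ-right u v) (×ₚ-right u′ v′)

factorˡ-extreme : ∀ s t (u u′ : Perm p) (v v′ : Perm q) →
  ExtremeIncl s t (u ×ₚ v) (u′ ×ₚ v′) → ExtremeIncl s t u u′
factorˡ-extreme {q = q} s t u u′ v v′ h a d E =
  extreme-image⁻ (_↑ˡ q) (↑ˡ-mono-< q) (u′ ×ₚ v′) u′ (×ₚ-pos-↑ˡ u′ v′) s t
    (h _ _ (extreme-image⁺ (_↑ˡ q) (↑ˡ-mono-< q) (u ×ₚ v) u (×ₚ-pos-↑ˡ u v) s t (↑ˡ-convex s) E))

factorʳ-extreme : ∀ s t (u u′ : Perm p) (v v′ : Perm q) →
  ExtremeIncl s t (u ×ₚ v) (u′ ×ₚ v′) → ExtremeIncl s t v v′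
factorʳ-extreme {p = p} s t u u′ v v′ h a d E =
  extreme-image⁻ (p ↑ʳ_) (↑ʳ-mono-< p) (u′ ×ₚ v′) v′ (×ₚ-pos-↑ʳ u′ v′) s t
    (h _ _ (extreme-image⁺ (p ↑ʳ_) (↑ʳ-mono-< p) (u ×ₚ v) v (×ₚ-pos-↑ʳ u v) s t (↑ʳ-convex s) E))

≡ᵗᴮ-translational : Translational (λ n → _≡ᵗᴮ_ {n})
≡ᵗᴮ-translational {u = u} {u′} {v} {v′} = mk⇔
  (λ h → (λ s t → factorˡ-extreme s t u u′ v v′ (proj₁ (h s t)) ,
                  factorˡ-extreme s t u′ u v′ v (proj₂ (h s t))) ,
         (λ s t → factorʳ-extreme s t u u′ v v′ (proj₁ (h s t)) ,
                  factorʳ-extreme s t u′ u v′ v (proj₂ (h s t))))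
  (λ (h , k) s t → ×ₚ-extreme s t u u′ v v′ (proj₁ (h s t)) (proj₁ (k s t)) ,
                   ×ₚ-extreme s t u′ u v′ v (proj₂ (h s t)) (proj₂ (k s t)))

≡ᵗᴮ-isHFamily : IsHFamily (λ n → _≡ᵗᴮ_ {n})
≡ᵗᴮ-isHFamily = record
  { isLatticeCongruence = ≡ᵗᴮ-isLatticeCongruence
  ; translational       = λ {p} {q} {u} {u′} {v} {v′} → ≡ᵗᴮ-translational {p} {q} {u} {u′} {v} {v′}
  ; insertional         = ≡ᵗᴮ-insertional
  }

-- Covering pairs and the generators

-- The inversions of `y` are those of `x` without (a , d). Naming the undone pair allows covers in
-- different parts of the weak order to be compared.
record Covers (a d : Fin n) (y x : Perm n) : Set where
  field
    inverted  : Inverted x a d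
    below     : y ≤ʷ x
    undone    : ¬ Inverted y a d
    preserved : ∀ {b c} → Inverted x b c → Inverted y b c ⊎ (b ≡ a × c ≡ d)

module _ {a d : Fin n} {y x : Perm n} (cov : Covers a d y x) where
  open Covers cov

  avoids⇒≤ : ∀ z → z ≤ʷ x → ¬ Inverted z a d → z ≤ʷ y
  avoids⇒≤ z z≤x ¬ad b c inv with preserved (z≤x b c inv)
  ... | inj₁ inv′ = inv′
  ... | inj₂ (refl , refl) = contradiction inv ¬ad

  contains⇒≥ : ∀ z → y ≤ʷ z → Inverted z a d → x ≤ʷ z
  contains⇒≥ z y≤z ad b c inv with preserved inv
  ... | inj₁ inv′ = y≤z b c inv′
  ... | inj₂ (refl , refl) = ad

  covers⇒<ʷ : y <ʷ x
  covers⇒<ʷ = below , λ y≈x → undone (≤ʷ-reflexive x y (sym ∘ y≈x) a d inverted)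

  covers⇒⋖ : y ⋖ x
  covers⇒⋖ = covers⇒<ʷ , λ (z , (y≤z , y≉z) , (z≤x , z≉x)) → case inverted? z a d of λ
    { (yes ad) → z≉x (≤ʷ-antisym z x z≤x (contains⇒≥ z y≤z ad))
    ; (no ¬ad) → y≉z (≤ʷ-antisym y z y≤z (avoids⇒≤ z z≤x ¬ad))
    }

-- Comparable covers that undo the same inversion are perspective.
module _ {a d : Fin n} {y x y′ x′ : Perm n} (cov : Covers a d y x) (cov′ : Covers a d y′ x′)
         {ℓ} {_∼_ : Rel (Perm n) ℓ} (isC : IsLatticeCongruence _∼_) where
  open IsLatticeCongruence isC
  private
    module C = Covers cov
    module C′ = Covers cov′
    module E = IsEquivalence isEquivalence

  perspective-up : x ≤ʷ x′ → x ∼ y → x′ ∼ y′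
  -- `x′` is the join of `x` and `y′`, and `y′` is the join of `y` and `y′`.
  perspective-up x≤x′ x∼y = ∨-cong
    (x≤x′ , C′.below , λ z x≤z y′≤z → contains⇒≥ cov′ z y′≤z (x≤z a d C.inverted))
    (avoids⇒≤ cov′ y (≤ʷ-trans y x x′ C.below x≤x′) C.undone , (λ _ _ h → h) , λ z _ y′≤z → y′≤z)
    x∼y (E.refl {y′})

  perspective-down : x′ ≤ʷ x → x ∼ y → x′ ∼ y′
  -- `x′` is the meet of `x` and `x′`, and `y′` is the meet of `y` and `x′`.
  perspective-down x′≤x x∼y = ∧-cong
    (x′≤x , (λ _ _ h → h) , λ z _ z≤x′ → z≤x′)
    (avoids⇒≤ cov y′ (≤ʷ-trans y′ x′ x C′.below x′≤x) C′.undone , C′.below ,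
      λ z z≤y z≤x′ → avoids⇒≤ cov′ z z≤x′ (C.undone ∘ z≤y a d))
    x∼y (E.refl {x′})

-- Transpositions of adjacent positions

swap : Fin n → Fin n → Perm n → Perm n
swap i j x = transpose i j ∘ₚ x

transpose-i : ∀ (i j : Fin n) → transpose i j ⟨$⟩ʳ i ≡ j
transpose-i i j rewrite dec-true (i ≟ i) refl = refl

transpose-j : ∀ (i j : Fin n) → transpose i j ⟨$⟩ʳ j ≡ i
transpose-j i j with j ≟ i
... | yes refl = refl
... | no _ rewrite dec-true (j ≟ j) refl = refl

transpose-other : ∀ (i j : Fin n) {k} → k ≢ i → k ≢ j → transpose i j ⟨$⟩ʳ k ≡ k
transpose-other i j {k} k≢i k≢j rewrite dec-false (k ≟ i) k≢i | dec-false (k ≟ j) k≢j = refl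

-- The inverse of `transpose i j` computes to `transpose j i`; this brings positions in `swap i j x`
-- back to `transpose i j`.
transpose-comm : ∀ (i j k : Fin n) → transpose i j ⟨$⟩ʳ k ≡ transpose j i ⟨$⟩ʳ k
transpose-comm i j k = case (k ≟ i) of λ
  { (yes refl) → trans (transpose-i i j) (sym (transpose-j j i))
  ; (no k≢i) → case (k ≟ j) of λ
    { (yes refl) → trans (transpose-j i j) (sym (transpose-i j i))
    ; (no k≢j) → trans (transpose-other i j k≢i k≢j) (sym (transpose-other j i k≢j k≢i))
    }
  }

module _ {i j : Fin n} (next : toℕ j ≡ ℕ.suc (toℕ i)) where

  next⇒< : i < j
  next⇒< = ℕ.≤-reflexive (sym next)

  <next : ∀ {k} → k < j → k ≢ i → k < i
  <next {k} k<j k≢i = ≮∧≢⇒> (λ i<k → ℕ.<⇒≱ (subst (toℕ k ℕ.<_) next k<j) i<k) (k≢i ∘ sym)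

  next< : ∀ {k} → i < k → k ≢ j → j < k
  next< {k} i<k k≢j = ≮∧≢⇒> (λ k<j → ℕ.<⇒≱ (subst (toℕ k ℕ.<_) next k<j) i<k) k≢j

  transpose-mono-< : ∀ {k l} → k < l →
    transpose i j ⟨$⟩ʳ k < transpose i j ⟨$⟩ʳ l ⊎ (k ≡ i × l ≡ j)
  transpose-mono-< {k} {l} k<l = go (k ≟ i) (k ≟ j) (l ≟ i) (l ≟ j)
    where
    τ-< : ∀ {k′ l′} → transpose i j ⟨$⟩ʳ k ≡ k′ → transpose i j ⟨$⟩ʳ l ≡ l′ → k′ < l′ →
          transpose i j ⟨$⟩ʳ k < transpose i j ⟨$⟩ʳ l ⊎ (k ≡ i × l ≡ j)
    τ-< eₖ eₗ h = inj₁ (subst₂ _<_ (sym eₖ) (sym eₗ) h)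

    go : Dec (k ≡ i) → Dec (k ≡ j) → Dec (l ≡ i) → Dec (l ≡ j) →
         transpose i j ⟨$⟩ʳ k < transpose i j ⟨$⟩ʳ l ⊎ (k ≡ i × l ≡ j)
    go (yes k≡i) _ _ (yes l≡j) = inj₂ (k≡i , l≡j)
    go (yes refl) _ (yes refl) _ = contradiction k<l (<-irrefl refl)
    go (yes refl) _ (no l≢i) (no l≢j) =
      τ-< (transpose-i i j) (transpose-other i j l≢i l≢j) (next< k<l l≢j)
    go (no _) (yes refl) (yes refl) _ = contradiction k<l (<-asym next⇒<)
    go (no _) (yes refl) (no _) (yes refl) = contradiction k<l (<-irrefl refl)
    go (no _) (yes refl) (no l≢i) (no l≢j) =
      τ-< (transpose-j i j) (transpose-other i j l≢i l≢j) (<-trans next⇒< k<l)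
    go (no k≢i) (no k≢j) (yes refl) _ =
      τ-< (transpose-other i j k≢i k≢j) (transpose-i i j) (<-trans k<l next⇒<)
    go (no k≢i) (no k≢j) (no _) (yes refl) =
      τ-< (transpose-other i j k≢i k≢j) (transpose-j i j) (<next k<l k≢i)
    go (no k≢i) (no k≢j) (no l≢i) (no l≢j) =
      τ-< (transpose-other i j k≢i k≢j) (transpose-other i j l≢i l≢j) k<l

  module _ (x : Perm n) where

    swap-pos : ∀ c → pos (swap i j x) c ≡ transpose i j ⟨$⟩ʳ pos x c
    swap-pos c = transpose-comm j i (pos x c)

    swap-mono : ∀ {b c} → pos x b < pos x c →
      pos (swap i j x) b < pos (swap i j x) c ⊎ (b ≡ x ⟨$⟩ʳ i × c ≡ x ⟨$⟩ʳ j)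
    swap-mono {b} {c} h with transpose-mono-< h
    ... | inj₁ h′ = inj₁ (subst₂ _<_ (sym (swap-pos b)) (sym (swap-pos c)) h′)
    ... | inj₂ (eᵢ , eⱼ) = inj₂ (trans (sym (inverseʳ x)) (cong (x ⟨$⟩ʳ_) eᵢ) ,
                                 trans (sym (inverseʳ x)) (cong (x ⟨$⟩ʳ_) eⱼ))

    ascent⇒≤swap : x ⟨$⟩ʳ i < x ⟨$⟩ʳ j → x ≤ʷ swap i j x
    ascent⇒≤swap asc b c (b<c , h) with swap-mono h
    ... | inj₁ h′ = b<c , h′
    ... | inj₂ (refl , refl) = contradiction b<c (<-asym asc)

    descent⇒covers : x ⟨$⟩ʳ j < x ⟨$⟩ʳ i → Covers (x ⟨$⟩ʳ j) (x ⟨$⟩ʳ i) (swap i j x) x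
    descent⇒covers desc = record
      { inverted  = desc , subst₂ _<_ (sym (inverseˡ x)) (sym (inverseˡ x)) next⇒<
      ; below     = below
      ; undone    = λ (_ , h) → <-asym h (subst₂ _<_
          (sym (trans (swap-pos _) (trans (cong (transpose i j ⟨$⟩ʳ_) (inverseˡ x)) (transpose-j i j))))
          (sym (trans (swap-pos _) (trans (cong (transpose i j ⟨$⟩ʳ_) (inverseˡ x)) (transpose-i i j))))
          next⇒<)
      ; preserved = preserved
      }
      where
      below : swap i j x ≤ʷ x
      -- Inversions are decidable, so a contradiction suffices: the swap keeps the order of a
      -- noninverted pair unless it sits at `i` and `j`, where `x` has a descent.
      below b c (b<c , h) = ¬¬ (λ ¬inv → case swap-mono (¬Inverted⇒ x b<c ¬inv) of λ
        { (inj₁ h′) → <-asym h h′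
        ; (inj₂ (refl , refl)) → <-asym desc b<c
        })
        where
        ¬¬ : ¬ ¬ Inverted x b c → Inverted x b c
        ¬¬ = decidable-stable (inverted? x b c)

      preserved : ∀ {b c} → Inverted x b c →
        Inverted (swap i j x) b c ⊎ (b ≡ x ⟨$⟩ʳ j × c ≡ x ⟨$⟩ʳ i)
      preserved (b<c , h) with swap-mono h
      ... | inj₁ h′ = inj₁ (b<c , h′)
      ... | inj₂ (eᵢ , eⱼ) = inj₂ (eⱼ , eᵢ)

record Between (a e d : Fin n) : Set where
  constructor _,_
  field
    lower : a < e
    upper : e < d

-- Neither an extremal pair of kind (⊕ , ⊕), which would need f left of a, nor
-- one of kind (⊖ , ⊖), which would need e right of d, is lost.
covers⇒≡ᵗᴮ : ∀ {a d e f : Fin n} {y x : Perm n} → Covers a d y x → Between a e d → Between a f d →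
              pos x e < pos x d → pos x a < pos x f → x ≡ᵗᴮ y
covers⇒≡ᵗᴮ {n} {a} {d} {e} {f} {y} {x} cov (a<e , e<d) (a<f , f<d) e◁d a◁f =
  ≡ᵗᴮ-from (λ t → t) x y λ
    { ⊕ → lost⊕ , Weak⇒ExtremeIncl ⊕ ⊕ y x (≤ʷ⇒Weak ⊕ y x below)
    ; ⊖ → lost⊖ , Weak⇒ExtremeIncl ⊖ ⊖ y x (≤ʷ⇒Weak ⊖ y x below)
    }
  where
  open Covers cov

  lost⊕ : ExtremeIncl ⊕ ⊕ x y
  lost⊕ a′ d′ E b a<b b≤d with preserved (a<b , E b a<b b≤d)
  ... | inj₁ (_ , h) = h
  ... | inj₂ (refl , refl) = contradiction (E f a<f (λ d′<f → b≤d (<-trans d′<f f<d))) (<-asym a◁f)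

  lost⊖ : ExtremeIncl ⊖ ⊖ x y
  lost⊖ d′ a′ E b b<d a≤b with preserved (b<d , E b b<d a≤b)
  ... | inj₁ (_ , h) = h
  ... | inj₂ (refl , refl) = contradiction (E e e<d (λ e<a′ → a≤b (<-trans a<e e<a′))) (<-asym e◁d)

-- Contraction of the two generators

increasing₄ : (g : Fin 4 → Fin m) → g 0F < g 1F → g 1F < g 2F → g 2F < g 3F →
              ∀ {i j} → i < j → g i < g j
increasing₄ g g01 g12 g23 {0F} {1F} _ = g01
increasing₄ g g01 g12 g23 {0F} {2F} _ = <-trans g01 g12
increasing₄ g g01 g12 g23 {0F} {3F} _ = <-trans g01 (<-trans g12 g23)
increasing₄ g g01 g12 g23 {1F} {2F} _ = g12
increasing₄ g g01 g12 g23 {1F} {3F} _ = <-trans g12 g23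
increasing₄ g g01 g12 g23 {2F} {3F} _ = g23
increasing₄ g g01 g12 g23 {1F} {1F} (s≤s ())
increasing₄ g g01 g12 g23 {2F} {1F} (s≤s ())
increasing₄ g g01 g12 g23 {3F} {1F} (s≤s ())
increasing₄ g g01 g12 g23 {2F} {2F} (s≤s (s≤s ()))
increasing₄ g g01 g12 g23 {3F} {2F} (s≤s (s≤s ()))
increasing₄ g g01 g12 g23 {3F} {3F} (s≤s (s≤s (s≤s ())))

module _ (γ : Perm 4) (γ01 : γ ⟨$⟩ʳ 0F < γ ⟨$⟩ʳ 1F) (γ21 : γ ⟨$⟩ʳ 2F < γ ⟨$⟩ʳ 1F)
         (γ23 : γ ⟨$⟩ʳ 2F < γ ⟨$⟩ʳ 3F) where

  -- Below `γ` the ascents of `γ` remain in order. With the pair at the descent reversed too, `z`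
  -- lists the values just as `γ` does.
  contains-descent⇒≥ : ∀ z → z ≤ʷ γ → Inverted z (γ ⟨$⟩ʳ 2F) (γ ⟨$⟩ʳ 1F) → γ ≤ʷ z
  contains-descent⇒≥ z z≤γ (_ , h) b c (b<c , h′) =
    b<c , subst₂ _<_ (cong (pos z) (inverseʳ γ)) (cong (pos z) (inverseʳ γ))
            (increasing₄ (λ i → pos z (γ ⟨$⟩ʳ i)) (asc γ01 (s≤s z≤n)) h
              (asc γ23 (s≤s (s≤s (s≤s z≤n)))) h′)
    where
    asc : ∀ {i j} → γ ⟨$⟩ʳ i < γ ⟨$⟩ʳ j → i < j → pos z (γ ⟨$⟩ʳ i) < pos z (γ ⟨$⟩ʳ j)
    asc γᵢ<γⱼ i<j = noninverted-anti z γ z≤γ γᵢ<γⱼ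
      (subst₂ _<_ (sym (inverseˡ γ)) (sym (inverseˡ γ)) i<j)

  -- Anything strictly below `γ` lacks the inversion at the descent, hence lies below `δ`; an
  -- element covered by `γ` leaves no room for `δ` strictly in between.
  covered⇒≈ : ∀ {δ γ* : Perm 4} → Covers (γ ⟨$⟩ʳ 2F) (γ ⟨$⟩ʳ 1F) δ γ → γ* ⋖ γ → γ* ≈ δ
  covered⇒≈ {δ} {γ*} cov ((γ*≤γ , γ*≉γ) , none) =
    decidable-stable (all? λ i → _ ≟ _) λ γ*≉δ → none (δ , (γ*≤δ , γ*≉δ) , covers⇒<ʷ cov)
    where
    γ*≤δ : γ* ≤ʷ δ
    γ*≤δ = avoids⇒≤ cov γ* γ*≤γ λ inv → γ*≉γ (≤ʷ-antisym γ* γ γ*≤γ (contains-descent⇒≥ γ* γ*≤γ inv))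

  contracts-≡ᵗᴮ : Between (γ ⟨$⟩ʳ 2F) (γ ⟨$⟩ʳ 0F) (γ ⟨$⟩ʳ 1F) →
                  Between (γ ⟨$⟩ʳ 2F) (γ ⟨$⟩ʳ 3F) (γ ⟨$⟩ʳ 1F) → Contracts _≡ᵗᴮ_ γ
  contracts-≡ᵗᴮ B B′ {γ*} γ*⋖γ = ≡ᵗᴮ-trans γ δ γ*
    (covers⇒≡ᵗᴮ cov B B′
      (subst₂ _<_ (sym (inverseˡ γ)) (sym (inverseˡ γ)) (s≤s z≤n))
      (subst₂ _<_ (sym (inverseˡ γ)) (sym (inverseˡ γ)) (s≤s (s≤s (s≤s z≤n)))))
    (≡ᵗᴮ-reflexive δ γ* (sym ∘ covered⇒≈ {δ} {γ*} cov γ*⋖γ))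
    where
    δ = swap 1F 2F γ
    cov = descent⇒covers refl γ γ21

contractsGenerators-≡ᵗᴮ : ContractsAll ⟨3412,2413⟩ (λ n → _≡ᵗᴮ_ {n})
contractsGenerators-≡ᵗᴮ g3412 {γ*} = contracts-≡ᵗᴮ perm3412 (s<s (s<s z<s)) z<s
  z<s (z<s , s<s (s<s z<s)) (z<s , s<s z<s) {γ*}
contractsGenerators-≡ᵗᴮ g2413 {γ*} = contracts-≡ᵗᴮ perm2413 (s<s z<s) z<s
  z<s (z<s , s<s z<s) (z<s , s<s (s<s z<s)) {γ*}

𝓗⇒≡ᵗᴮ : ∀ {x y : Perm n} → 𝓗 ⟨3412,2413⟩ n x y → x ≡ᵗᴮ y
𝓗⇒≡ᵗᴮ = 𝓗-smallest ⟨3412,2413⟩ (λ _ → _≡ᵗᴮ_) ≡ᵗᴮ-isHFamily contractsGenerators-≡ᵗᴮ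

-- Contractible descents

subset : {P : Fin n → Set} → (∀ a → Dec (P a)) → Subset n
subset P? = tabulate (does ∘ P?)

∈-subset⁺ : ∀ {P : Fin n → Set} (P? : ∀ a → Dec (P a)) {a} → P a → a ∈ subset P?
∈-subset⁺ P? {a} Pa = lookup⇒[]= a _ (trans (lookup∘tabulate (does ∘ P?) a) (dec-true (P? a) Pa))

∈-subset⁻ : ∀ {P : Fin n → Set} (P? : ∀ a → Dec (P a)) {a} → a ∈ subset P? → P a
∈-subset⁻ P? {a} a∈ with P? a | trans (sym (lookup∘tabulate (does ∘ P?) a)) ([]=⇒lookup a∈)
... | yes Pa | _ = Pa
... | no _ | ()

indicator : Bool → ℕ
indicator b = if b then 1 else 0

-- As a sum, a cardinality can be reindexed along a permutation.
∣tabulate∣ : ∀ {n} (f : Fin n → Bool) → ∣ tabulate f ∣ ≡ sum (indicator ∘ f)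
∣tabulate∣ {ℕ.zero} f = refl
∣tabulate∣ {ℕ.suc n} f with f zero
... | true  = cong ℕ.suc (∣tabulate∣ (f ∘ suc))
... | false = ∣tabulate∣ (f ∘ suc)

sum-indicator-< : ∀ p q → sum {p ℕ.+ q} (λ i → indicator (does (toℕ i ℕ.<? p))) ≡ p
sum-indicator-< ℕ.zero q = sum-replicate-zero q
sum-indicator-< (ℕ.suc p) q = cong ℕ.suc (sum-indicator-< p q)

module _ {p q} (x : Perm (p ℕ.+ q)) where

  leftPosition? : ∀ a → Dec (toℕ (pos x a) ℕ.< p)
  leftPosition? a = toℕ (pos x a) ℕ.<? p

  -- The set Q for which `x` is the insertion of the standardizations of its own two blocks.
  leftValues : Subset (p ℕ.+ q)
  leftValues = subset leftPosition?

  -- Reindexing along `x` turns the count of values into a count of the positions below `p`.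
  ∣leftValues∣ : ∣ leftValues ∣ ≡ p
  ∣leftValues∣ = trans (∣tabulate∣ (does ∘ leftPosition?))
    (trans (sum-permute (indicator ∘ does ∘ leftPosition?) x)
      (trans (sum-cong-≗ (λ i → cong (λ l → indicator (does (toℕ l ℕ.<? p))) (inverseˡ x {i})))
        (sum-indicator-< p q)))

  leftValues-⇔ : ∀ a → a ∈ leftValues ⇔ (∃[ i ] x ⟨$⟩ʳ (i ↑ˡ q) ≡ a)
  leftValues-⇔ a = mk⇔ (λ a∈ → to (block p (pos x a)) (inverseʳ x) (∈-subset⁻ leftPosition? a∈))
    λ { (i , refl) → ∈-subset⁺ leftPosition?
          (subst (ℕ._< p) (sym (trans (cong toℕ (inverseˡ x)) (toℕ-↑ˡ i q))) (toℕ<n i)) }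
    where
    to : ∀ {c} → Block c → x ⟨$⟩ʳ c ≡ a → toℕ c ℕ.< p → ∃[ i ] x ⟨$⟩ʳ (i ↑ˡ q) ≡ a
    to (inLeft i) e _ = i , e
    to (inRight j) _ h = contradiction (ℕ.m≤m+n p (toℕ j)) (ℕ.<⇒≱ (subst (ℕ._< p) (toℕ-↑ʳ p j) h))

-- Rearranging a factor by insertion

module _ {C : JoinIrreducibles} where

  -- Rearranging the entries inside each block keeps the set of left values, so `x` and `x′` arise
  -- by insertion along the same set; the new standardizations are `τ ∘ₚ u` and `ρ ∘ₚ v`.
  permute-blocks : ∀ {p q} (x x′ : Perm (p ℕ.+ q)) (τ : Perm p) (ρ : Perm q) {u v} →
    (∀ i → x′ ⟨$⟩ʳ (i ↑ˡ q) ≡ x ⟨$⟩ʳ ((τ ⟨$⟩ʳ i) ↑ˡ q)) →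
    (∀ j → x′ ⟨$⟩ʳ (p ↑ʳ j) ≡ x ⟨$⟩ʳ (p ↑ʳ (ρ ⟨$⟩ʳ j))) →
    IsStandardization (λ i → x ⟨$⟩ʳ (i ↑ˡ q)) u → IsStandardization (λ j → x ⟨$⟩ʳ (p ↑ʳ j)) v →
    𝓗 C p u (τ ∘ₚ u) → 𝓗 C q v (ρ ∘ₚ v) → 𝓗 C (p ℕ.+ q) x x′
  permute-blocks {p} {q} x x′ τ ρ {u} {v} left right stu stv =
    insert-𝓗 {p = p} {q} (leftValues {p} x) (∣leftValues∣ {p} x)
      (record { values = leftValues-⇔ {p} x ; left = stu ; right = stv })
      (record { values = λ a → mk⇔
                  (λ a∈ → let i , e = Equivalence.to (leftValues-⇔ {p} x a) a∈ in
                     pos τ i , trans (left _) (trans (cong (λ l → x ⟨$⟩ʳ (l ↑ˡ q)) (inverseʳ τ)) e))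
                  (λ (i , e) → Equivalence.from (leftValues-⇔ {p} x a) (τ ⟨$⟩ʳ i , trans (sym (left i)) e))
              ; left  = λ i j → mk⇔
                  (subst₂ _<_ (sym (left i)) (sym (left j)) ∘ Equivalence.to (stu _ _))
                  (Equivalence.from (stu _ _) ∘ subst₂ _<_ (left i) (left j))
              ; right = λ i j → mk⇔
                  (subst₂ _<_ (sym (right i)) (sym (right j)) ∘ Equivalence.to (stv _ _))
                  (Equivalence.from (stv _ _) ∘ subst₂ _<_ (right i) (right j))
              })

  transpose-map : (f : Fin m → Fin n) → (∀ {i j} → f i ≡ f j → i ≡ j) → ∀ i j k →
                  transpose (f i) (f j) ⟨$⟩ʳ f k ≡ f (transpose i j ⟨$⟩ʳ k)
  transpose-map f f-inj i j k = case (k ≟ i) of λ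
    { (yes refl) → trans (transpose-i (f i) (f j)) (cong f (sym (transpose-i i j)))
    ; (no k≢i) → case (k ≟ j) of λ
      { (yes refl) → trans (transpose-j (f i) (f j)) (cong f (sym (transpose-j i j)))
      ; (no k≢j) → trans (transpose-other (f i) (f j) (k≢i ∘ f-inj) (k≢j ∘ f-inj))
                         (cong f (sym (transpose-other i j k≢i k≢j)))
      }
    }

  swap-left : ∀ {p q} (x : Perm (p ℕ.+ q)) {u : Perm p} i j →
    IsStandardization (λ i → x ⟨$⟩ʳ (i ↑ˡ q)) u → 𝓗 C p u (swap i j u) →
    𝓗 C (p ℕ.+ q) x (swap (i ↑ˡ q) (j ↑ˡ q) x)
  swap-left {p} {q} x {u} i j st h =
    let v , stv = standardization (λ j → x ⟨$⟩ʳ (p ↑ʳ j)) (↑ʳ-injective p _ _ ∘ val-injective x) in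
    permute-blocks x (swap (i ↑ˡ q) (j ↑ˡ q) x) (transpose i j) id {u} {v}
      (λ k → cong (x ⟨$⟩ʳ_) (transpose-map (_↑ˡ q) (↑ˡ-injective q _ _) i j k))
      (λ k → cong (x ⟨$⟩ʳ_) (transpose-other (i ↑ˡ q) (j ↑ˡ q) (↑ˡ≢↑ʳ i k ∘ sym) (↑ˡ≢↑ʳ j k ∘ sym)))
      st stv h (reflexive-𝓗 (λ _ → refl))

  swap-right : ∀ {p q} (x : Perm (p ℕ.+ q)) {v : Perm q} i j →
    IsStandardization (λ j → x ⟨$⟩ʳ (p ↑ʳ j)) v → 𝓗 C q v (swap i j v) →
    𝓗 C (p ℕ.+ q) x (swap (p ↑ʳ i) (p ↑ʳ j) x)
  swap-right {p} {q} x {v} i j st h =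
    let u , stu = standardization (λ i → x ⟨$⟩ʳ (i ↑ˡ q)) (↑ˡ-injective q _ _ ∘ val-injective x) in
    permute-blocks x (swap (p ↑ʳ i) (p ↑ʳ j) x) id (transpose i j) {u} {v}
      (λ k → cong (x ⟨$⟩ʳ_) (transpose-other (p ↑ʳ i) (p ↑ʳ j) (↑ˡ≢↑ʳ k i) (↑ˡ≢↑ʳ k j)))
      (λ k → cong (x ⟨$⟩ʳ_) (transpose-map (p ↑ʳ_) (↑ʳ-injective p _ _) i j k))
      stu st (reflexive-𝓗 (λ _ → refl)) h

  -- Two insertions: one splits off the first `p` letters, the other the last `q`.
  swap-middle : ∀ {p m q} (x : Perm (p ℕ.+ (m ℕ.+ q))) {γ : Perm m} i j →
    IsStandardization (λ i → x ⟨$⟩ʳ (p ↑ʳ (i ↑ˡ q))) γ → 𝓗 C m γ (swap i j γ) →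
    𝓗 C (p ℕ.+ (m ℕ.+ q)) x (swap (p ↑ʳ (i ↑ˡ q)) (p ↑ʳ (j ↑ˡ q)) x)
  swap-middle {p} {m} {q} x i j st h =
    let v , stv = standardization (λ j → x ⟨$⟩ʳ (p ↑ʳ j)) (↑ʳ-injective p _ _ ∘ val-injective x) in
    swap-right x (i ↑ˡ q) (j ↑ˡ q) stv (swap-left v i j
      (λ k l → mk⇔ (Equivalence.from (stv _ _) ∘ Equivalence.to (st k l))
                   (Equivalence.from (st k l) ∘ Equivalence.to (stv _ _))) h)

infix 4 _~_
_~_ : Rel (Perm n) 0ℓ
_~_ {n} = 𝓗 ⟨3412,2413⟩ n

generator-swap : {γ : Perm 4} → Generator γ → γ ⟨$⟩ʳ 2F < γ ⟨$⟩ʳ 1F → γ ~ swap 1F 2F γ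
generator-swap {γ} g desc = contract g (covers⇒⋖ (descent⇒covers refl γ desc))

-- An occurrence of 2413 or 3412 with adjacent "4" and "1", at `i` and `j`. Leaving the order of the
-- entries at `k` and `l` open treats both patterns at once.
record ContractibleDescent (x : Perm n) (k i j l : Fin n) : Set where
  field
    next  : toℕ j ≡ ℕ.suc (toℕ i)
    k<i   : k < i
    j<l   : j < l
    k-mid : Between (x ⟨$⟩ʳ j) (x ⟨$⟩ʳ k) (x ⟨$⟩ʳ i)
    l-mid : Between (x ⟨$⟩ʳ j) (x ⟨$⟩ʳ l) (x ⟨$⟩ʳ i)

  descent : x ⟨$⟩ʳ j < x ⟨$⟩ʳ i
  descent = <-trans (Between.lower k-mid) (Between.upper k-mid)

increasing⇒standardization₄ : (a : Fin 4 → Fin m) (γ : Perm 4) →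
  a (pos γ 0F) < a (pos γ 1F) → a (pos γ 1F) < a (pos γ 2F) → a (pos γ 2F) < a (pos γ 3F) →
  IsStandardization a γ
increasing⇒standardization₄ a γ h₀ h₁ h₂ = mono⇒isStandardization a γ
  (subst₂ _<_ (cong a (inverseˡ γ)) (cong a (inverseˡ γ)) ∘ increasing₄ (a ∘ pos γ) h₀ h₁ h₂)

pattern-standardization : (a : Fin 4 → Fin m) → a 0F ≢ a 3F →
  Between (a 2F) (a 0F) (a 1F) → Between (a 2F) (a 3F) (a 1F) →
  IsStandardization a perm2413 ⊎ IsStandardization a perm3412
pattern-standardization a a₀≢a₃ (l₀ , u₀) (l₃ , u₃) with <-total a₀≢a₃
... | inj₁ a₀<a₃ = inj₁ (increasing⇒standardization₄ a perm2413 l₀ a₀<a₃ u₃)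
... | inj₂ a₃<a₀ = inj₂ (increasing⇒standardization₄ a perm3412 l₃ a₃<a₀ u₀)

-- The four entries form a factor with `p` letters before it and `r` after it, and its
-- standardization is a generator.
consecutive : ∀ p r {n} (x : Perm n) {k i j l} → n ≡ p ℕ.+ (4 ℕ.+ r) → ContractibleDescent x k i j l →
  toℕ k ≡ p → toℕ i ≡ ℕ.suc (toℕ k) → toℕ l ≡ ℕ.suc (toℕ j) → x ~ swap i j x
consecutive p r x {k} {i} {j} {l} refl D ek ei el = go
  (toℕ-injective (trans ek (at 0F)))
  (toℕ-injective (trans ei′ (at 1F)))
  (toℕ-injective (trans ej′ (at 2F)))
  (toℕ-injective (trans (trans el (cong ℕ.suc ej′)) (at 3F)))
  D
  where
  w : Fin 4 → Fin (p ℕ.+ (4 ℕ.+ r))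
  w c = p ↑ʳ (c ↑ˡ r)

  at : ∀ c → toℕ c ℕ.+ p ≡ toℕ (w c)
  at c = trans (ℕ.+-comm (toℕ c) p)
    (sym (trans (toℕ-↑ʳ p (c ↑ˡ r)) (cong (p ℕ.+_) (toℕ-↑ˡ c r))))

  ei′ : toℕ i ≡ 1 ℕ.+ p
  ei′ = trans ei (cong ℕ.suc ek)

  ej′ : toℕ j ≡ 2 ℕ.+ p
  ej′ = trans (ContractibleDescent.next D) (cong ℕ.suc ei′)

  go : ∀ {k i j l} → k ≡ w 0F → i ≡ w 1F → j ≡ w 2F → l ≡ w 3F →
       ContractibleDescent x k i j l → x ~ swap i j x
  go refl refl refl refl D with pattern-standardization (λ c → x ⟨$⟩ʳ w c)
      (λ e → case ↑ˡ-injective r 0F 3F (↑ʳ-injective p _ _ (val-injective x e)) of λ ())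
      (ContractibleDescent.k-mid D) (ContractibleDescent.l-mid D)
  ... | inj₁ st = swap-middle x 1F 2F st (generator-swap g2413 z<s)
  ... | inj₂ st = swap-middle x 1F 2F st (generator-swap g3412 z<s)

-- Both covers undo the inversion of the same two values, and swapping `k` and `k′` moves up or down
-- in the weak order, so they are perspective in one direction or the other.
disjoint-swap : ∀ (x : Perm n) {k k′ i j} → toℕ k′ ≡ ℕ.suc (toℕ k) → toℕ j ≡ ℕ.suc (toℕ i) →
  k ≢ i → k ≢ j → k′ ≢ i → k′ ≢ j → x ⟨$⟩ʳ j < x ⟨$⟩ʳ i →
  swap k k′ x ~ swap i j (swap k k′ x) → x ~ swap i j x
disjoint-swap {n} x {k} {k′} {i} {j} nextₖ nextᵢ k≢i k≢j k′≢i k′≢j desc h =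
  case <-total (<⇒≢ (next⇒< nextₖ) ∘ val-injective x) of λ
    { (inj₁ asc) → perspective-down cov₁ cov 𝓗-cong (ascent⇒≤swap nextₖ x asc) h
    ; (inj₂ desc′) → perspective-up cov₁ cov 𝓗-cong (Covers.below (descent⇒covers nextₖ x desc′)) h
    }
  where
  x₁ = swap k k′ x

  𝓗-cong : IsLatticeCongruence (_~_ {n})
  𝓗-cong = IsHFamily.isLatticeCongruence (𝓗-isHFamily ⟨3412,2413⟩) n

  eᵢ : x₁ ⟨$⟩ʳ i ≡ x ⟨$⟩ʳ i
  eᵢ = cong (x ⟨$⟩ʳ_) (transpose-other k k′ (k≢i ∘ sym) (k′≢i ∘ sym))

  eⱼ : x₁ ⟨$⟩ʳ j ≡ x ⟨$⟩ʳ j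
  eⱼ = cong (x ⟨$⟩ʳ_) (transpose-other k k′ (k≢j ∘ sym) (k′≢j ∘ sym))

  cov : Covers (x ⟨$⟩ʳ j) (x ⟨$⟩ʳ i) (swap i j x) x
  cov = descent⇒covers nextᵢ x desc

  cov₁ : Covers (x ⟨$⟩ʳ j) (x ⟨$⟩ʳ i) (swap i j x₁) x₁
  cov₁ = subst₂ (λ a d → Covers a d (swap i j x₁) x₁) eⱼ eᵢ
    (descent⇒covers nextᵢ x₁ (subst₂ _<_ (sym eⱼ) (sym eᵢ) desc))

between-resp : ∀ {a a′ e e′ d d′ : Fin n} → a ≡ a′ → e ≡ e′ → d ≡ d′ → Between a e d → Between a′ e′ d′
between-resp refl refl refl b = b

-- The entries in the roles of 2 and 3 are moved next to the descent by
-- transpositions that do not touch it.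
contract-right : ∀ m (x : Perm n) {k i j l} → ContractibleDescent x k i j l →
  toℕ i ≡ ℕ.suc (toℕ k) → toℕ l ≡ ℕ.suc (m ℕ.+ toℕ j) → x ~ swap i j x
contract-right {n} ℕ.zero x {k} {i} {j} {l} D eᵢ eₗ =
  -- The factor starts at `k`, so `toℕ k` letters precede it; what remains after its four letters
  -- follows.
  consecutive (toℕ k) (n ℕ.∸ (toℕ k ℕ.+ 4)) x
    (trans (sym (ℕ.m+[n∸m]≡n 4+k≤n)) (ℕ.+-assoc (toℕ k) 4 _)) D refl eᵢ eₗ
  where
  4+k≤n : toℕ k ℕ.+ 4 ℕ.≤ n
  4+k≤n = subst (ℕ._≤ n)
    (trans (cong ℕ.suc (trans eₗ (cong ℕ.suc (trans (ContractibleDescent.next D) (cong ℕ.suc eᵢ)))))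
           (ℕ.+-comm 4 (toℕ k)))
    (toℕ<n l)
-- The first argument counts the letters strictly between `j` and `l`; the entry at `l` moves one
-- place left, to `l′`.
contract-right (ℕ.suc m) x {k} {i} {j} {l} D eᵢ eₗ =
  disjoint-swap x (trans eₗ (cong ℕ.suc (sym eₗ′))) next
    (<⇒≢ i<l′ ∘ sym) (<⇒≢ j<l′ ∘ sym) (<⇒≢ i<l ∘ sym) (<⇒≢ j<l ∘ sym) descent
    (contract-right m x₁ D₁ eᵢ eₗ′)
  where
  open ContractibleDescent D

  l′<n : ℕ.suc (m ℕ.+ toℕ j) ℕ.< _
  l′<n = ℕ.<-trans (ℕ.≤-reflexive (sym eₗ)) (toℕ<n l)

  l′ = fromℕ< l′<n

  eₗ′ : toℕ l′ ≡ ℕ.suc (m ℕ.+ toℕ j)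
  eₗ′ = toℕ-fromℕ< l′<n

  j<l′ : j < l′
  j<l′ = subst (toℕ j ℕ.<_) (sym eₗ′) (s≤s (ℕ.m≤n+m _ m))

  i<l′ = <-trans (next⇒< next) j<l′
  i<l = <-trans (next⇒< next) j<l
  k<l′ = <-trans k<i i<l′
  k<l = <-trans k<i i<l
  x₁ = swap l′ l x

  fixed : ∀ {c} → c < l′ → c < l → x ⟨$⟩ʳ c ≡ x₁ ⟨$⟩ʳ c
  fixed c<l′ c<l = cong (x ⟨$⟩ʳ_) (sym (transpose-other l′ l (<⇒≢ c<l′) (<⇒≢ c<l)))

  D₁ : ContractibleDescent x₁ k i j l′
  D₁ = record
    { next = next ; k<i = k<i ; j<l = j<l′
    ; k-mid = between-resp (fixed j<l′ j<l) (fixed k<l′ k<l) (fixed i<l′ i<l) k-mid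
    ; l-mid = between-resp (fixed j<l′ j<l) (cong (x ⟨$⟩ʳ_) (sym (transpose-i l′ l))) (fixed i<l′ i<l) l-mid
    }

contract-left : ∀ m (x : Perm n) {k i j l} → ContractibleDescent x k i j l →
  toℕ i ≡ ℕ.suc (m ℕ.+ toℕ k) → x ~ swap i j x
contract-left ℕ.zero x {j = j} {l} D eᵢ = contract-right (toℕ l ℕ.∸ ℕ.suc (toℕ j)) x D eᵢ
  (trans (sym (ℕ.m∸n+n≡m (ContractibleDescent.j<l D))) (ℕ.+-suc _ _))
contract-left (ℕ.suc m) x {k} {i} {j} {l} D eᵢ =
  disjoint-swap x eₖ′ next
    (<⇒≢ k<i) (<⇒≢ k<j) (<⇒≢ k′<i) (<⇒≢ k′<j) descent
    (contract-left m x₁ D₁ (trans eᵢ (cong ℕ.suc (trans (sym (ℕ.+-suc m _)) (cong (m ℕ.+_) (sym eₖ′))))))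
  where
  open ContractibleDescent D

  1+k<i : ℕ.suc (toℕ k) ℕ.< toℕ i
  1+k<i = subst (ℕ.suc (toℕ k) ℕ.<_) (sym eᵢ) (s≤s (s≤s (ℕ.m≤n+m _ m)))

  k′ = fromℕ< (ℕ.<-trans 1+k<i (toℕ<n i))

  eₖ′ : toℕ k′ ≡ ℕ.suc (toℕ k)
  eₖ′ = toℕ-fromℕ< _

  k′<i : k′ < i
  k′<i = subst (ℕ._< toℕ i) (sym eₖ′) 1+k<i

  k′<j = <-trans k′<i (next⇒< next)
  k<j = <-trans k<i (next⇒< next)
  x₁ = swap k k′ x

  fixed : ∀ {c} → k < c → k′ < c → x ⟨$⟩ʳ c ≡ x₁ ⟨$⟩ʳ c
  fixed k<c k′<c = cong (x ⟨$⟩ʳ_) (sym (transpose-other k k′ (<⇒≢ k<c ∘ sym) (<⇒≢ k′<c ∘ sym)))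

  D₁ : ContractibleDescent x₁ k′ i j l
  D₁ = record
    { next = next ; k<i = k′<i ; j<l = j<l
    ; k-mid = between-resp (fixed k<j k′<j) (cong (x ⟨$⟩ʳ_) (sym (transpose-j k k′))) (fixed k<i k′<i) k-mid
    ; l-mid = between-resp (fixed k<j k′<j)
        (fixed (<-trans k<j j<l) (<-trans k′<j j<l)) (fixed k<i k′<i) l-mid
    }

contractible⇒~ : ∀ (x : Perm n) {k i j l} → ContractibleDescent x k i j l → x ~ swap i j x
contractible⇒~ x {k} {i} D = contract-left (toℕ i ℕ.∸ ℕ.suc (toℕ k)) x D
  (trans (sym (ℕ.m∸n+n≡m (ContractibleDescent.k<i D))) (ℕ.+-suc _ _))

-- Normal forms

Irreducible : Perm n → Set
Irreducible x = ∀ {k i j l} → ¬ ContractibleDescent x k i j l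

-- Pairs are coded in `Fin (n * n)` to obtain a subset of a finite set; its strict inclusion is the
-- termination measure of `normalForm`.
inversions : Perm n → Subset (n ℕ.* n)
inversions {n} x = subset λ c → inverted? x (proj₁ (remQuot {n} n c)) (proj₂ (remQuot {n} n c))

covers⇒⊂ : ∀ {a d : Fin n} {y x : Perm n} → Covers a d y x → inversions y ⊂ inversions x
covers⇒⊂ {n} {a} {d} {y} {x} cov =
  (λ c∈ → ∈-subset⁺ (inv? x) (below _ _ (∈-subset⁻ (inv? y) c∈))) ,
  combine a d ,
  ∈-subset⁺ (inv? x) (subst (λ (a , d) → Inverted x a d) (sym (remQuot-combine a d)) inverted) ,
  λ c∈ → undone (subst (λ (a , d) → Inverted y a d) (remQuot-combine a d) (∈-subset⁻ (inv? y) c∈))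
  where
  open Covers cov

  inv? : ∀ (x : Perm n) (c : Fin (n ℕ.* n)) →
         Dec (Inverted x (proj₁ (remQuot {n} n c)) (proj₂ (remQuot {n} n c)))
  inv? x c = inverted? x _ _

between? : ∀ (a e d : Fin n) → Dec (Between a e d)
between? a e d = map′ (λ (l , u) → l , u) (λ (l , u) → l , u) (a <? e ×-dec e <? d)

contractibleDescent? : ∀ (x : Perm n) k i j l → Dec (ContractibleDescent x k i j l)
contractibleDescent? x k i j l = map′
  (λ (h₁ , h₂ , h₃ , h₄ , h₅) → record { next = h₁ ; k<i = h₂ ; j<l = h₃ ; k-mid = h₄ ; l-mid = h₅ })
  (λ D → let open ContractibleDescent D in next , k<i , j<l , k-mid , l-mid)
  (toℕ j ℕ.≟ ℕ.suc (toℕ i) ×-dec k <? i ×-dec j <? l ×-dec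
   between? (x ⟨$⟩ʳ j) (x ⟨$⟩ʳ k) (x ⟨$⟩ʳ i) ×-dec between? (x ⟨$⟩ʳ j) (x ⟨$⟩ʳ l) (x ⟨$⟩ʳ i))

normalForm : ∀ (x : Perm n) → ∃[ z ] (Irreducible z × x ~ z)
normalForm {n} x = go x (⊂-wellFounded (inversions x))
  where
  go : ∀ x → Acc _⊂_ (inversions x) → ∃[ z ] (Irreducible z × x ~ z)
  go x (acc rec) with any? (λ k → any? λ i → any? λ j → any? λ l → contractibleDescent? x k i j l)
  ... | no none = x , (λ {k} {i} {j} {l} D → none (k , i , j , l , D)) , reflexive-𝓗 (λ _ → refl)
  ... | yes (k , i , j , l , D) =
    let z , irr , h = go (swap i j x) (rec (covers⇒⊂ {y = swap i j x} {x} (descent⇒covers next x descent)))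
    in z , irr , transitive (contractible⇒~ x D) h
    where open ContractibleDescent D

-- Irreducible permutations are the twisted Baxter permutations

irreducible⇒neverAdjacent : ∀ {x : Perm n} {γ : Perm 4} → Irreducible x →
  Between (γ ⟨$⟩ʳ 2F) (γ ⟨$⟩ʳ 0F) (γ ⟨$⟩ʳ 1F) → Between (γ ⟨$⟩ʳ 2F) (γ ⟨$⟩ʳ 3F) (γ ⟨$⟩ʳ 1F) →
  (o : Occurrence γ x) → ¬ Adjacent (Occurrence.index o 1F) (Occurrence.index o 2F)
irreducible⇒neverAdjacent irr (l₀ , u₀) (l₃ , u₃) o = λ
  { (inj₁ next) → irr (record
      { next  = next
      ; k<i   = increasing z<s
      ; j<l   = increasing (s<s (s<s z<s))
      ; k-mid = order l₀ , order u₀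
      ; l-mid = order l₃ , order u₃
      })
  ; (inj₂ prev) → <-asym (increasing {1F} {2F} (s<s z<s)) (ℕ.≤-reflexive (sym prev))
  }
  where
  open Occurrence o

  order : ∀ {i j} → _ → _
  order {i} {j} = Equivalence.to (sameOrder i j)

irreducible⇒twistedBaxter : ∀ {x : Perm n} → Irreducible x → IsTwistedBaxter x
irreducible⇒twistedBaxter irr =
  irreducible⇒neverAdjacent {γ = perm2413} irr (z<s , s<s z<s) (z<s , s<s (s<s z<s)) ,
  irreducible⇒neverAdjacent {γ = perm3412} irr (z<s , s<s (s<s z<s)) (z<s , s<s z<s)

twistedBaxter⇒irreducible : ∀ {x : Perm n} → IsTwistedBaxter x → Irreducible x
twistedBaxter⇒irreducible {n} {x} (no2413 , no3412) {k} {i} {j} {l} D =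
  case pattern-standardization (λ c → x ⟨$⟩ʳ index c)
    (<⇒≢ (index-mono {0F} {3F} z<s) ∘ val-injective x) k-mid l-mid of λ
  { (inj₁ st) → no2413 (record { index = index ; increasing = index-mono ; sameOrder = st }) (inj₁ next)
  ; (inj₂ st) → no3412 (record { index = index ; increasing = index-mono ; sameOrder = st }) (inj₁ next)
  }
  where
  open ContractibleDescent D

  index : Fin 4 → Fin n
  index = lookup (k ∷ i ∷ j ∷ l ∷ [])

  index-mono : ∀ {c d} → c < d → index c < index d
  index-mono = increasing₄ index k<i (next⇒< next) j<l

-- A discrete intermediate value argument: on the way from `i` to `j` some single step drops from at
-- least `v` to below `v`. `N` counts the positions strictly between.
crossing : ∀ N (z : Perm n) (v : Fin n) {i j} → toℕ j ≡ ℕ.suc (N ℕ.+ toℕ i) → v ≤ z ⟨$⟩ʳ i → z ⟨$⟩ʳ j < v →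
  ∃[ i′ ] ∃[ j′ ] (toℕ j′ ≡ ℕ.suc (toℕ i′) × i ≤ i′ × j′ ≤ j × v ≤ z ⟨$⟩ʳ i′ × z ⟨$⟩ʳ j′ < v)
crossing ℕ.zero z v {i} {j} e above below = i , j , e , ℕ.≤-refl , ℕ.≤-refl , above , below
crossing {n} (ℕ.suc N) z v {i} {j} e above below = step (z ⟨$⟩ʳ i⁺ <? v)
  where
  i⁺<j : ℕ.suc (toℕ i) ℕ.< toℕ j
  i⁺<j = subst (ℕ.suc (toℕ i) ℕ.<_) (sym e) (s≤s (s≤s (ℕ.m≤n+m (toℕ i) N)))

  i⁺ : Fin n
  i⁺ = fromℕ< (ℕ.<-trans i⁺<j (toℕ<n j))

  e⁺ : toℕ i⁺ ≡ ℕ.suc (toℕ i)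
  e⁺ = toℕ-fromℕ< _

  step : Dec (z ⟨$⟩ʳ i⁺ < v) → _
  step (yes below⁺) = i , i⁺ , e⁺ , ℕ.≤-refl ,
    ℕ.≤-trans (ℕ.≤-reflexive e⁺) (ℕ.<⇒≤ i⁺<j) , above , below⁺
  step (no above⁺) =
    let i′ , j′ , next , i⁺≤i′ , rest =
          crossing N z v
            (trans e (cong ℕ.suc (trans (sym (ℕ.+-suc N (toℕ i))) (cong (N ℕ.+_) (sym e⁺)))))
            (ℕ.≮⇒≥ above⁺) below
    in i′ , j′ , next , ℕ.≤-trans (ℕ.≤-trans (ℕ.n≤1+n _) (ℕ.≤-reflexive (sym e⁺))) i⁺≤i′ , rest

crossing⇒contractible : ∀ (z : Perm n) {a d e f} → Inverted z a d →
  (∀ b → Between a b d → ¬ Between (pos z d) (pos z b) (pos z a)) →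
  Between a e d → pos z e < pos z d → Between a f d → pos z a < pos z f →
  ∃[ i ] ∃[ j ] ContractibleDescent z (pos z e) i j (pos z f)
crossing⇒contractible z {a} {d} {e} {f} (a<d , d◁a) none (a<e , e<d) e◁d (a<f , f<d) a◁f =
  let i , j , next , d⊴i , j⊴a , d≤zi , zj<d =
        crossing (toℕ (pos z a) ℕ.∸ ℕ.suc (toℕ (pos z d))) z d
          (trans (sym (ℕ.m∸n+n≡m d◁a)) (ℕ.+-suc _ _))
          (ℕ.≤-reflexive (cong toℕ (sym (inverseʳ z))))
          (subst (_< d) (sym (inverseʳ z)) a<d)
      zj≤a : z ⟨$⟩ʳ j ≤ a
      zj≤a = ℕ.≮⇒≥ λ a<zj → none (z ⟨$⟩ʳ j) (a<zj , zj<d)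
        ( subst (pos z d <_) (sym (inverseˡ z)) (ℕ.≤-<-trans d⊴i (next⇒< next))
        , subst (_< pos z a) (sym (inverseˡ z)) (≤∧≢⇒< j⊴a λ j≡a →
            <-irrefl (trans (sym (inverseʳ z)) (cong (z ⟨$⟩ʳ_) (sym j≡a))) a<zj) )
      mid : ∀ {c} → a < c → c < d → Between (z ⟨$⟩ʳ j) (z ⟨$⟩ʳ pos z c) (z ⟨$⟩ʳ i)
      mid a<c c<d = subst (λ c → Between (z ⟨$⟩ʳ j) c (z ⟨$⟩ʳ i)) (sym (inverseʳ z))
        (ℕ.≤-<-trans zj≤a a<c , ℕ.<-≤-trans c<d d≤zi)
  in i , j , record
    { next  = next
    ; k<i   = ℕ.<-≤-trans e◁d d⊴i
    ; j<l   = ℕ.≤-<-trans j⊴a a◁f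
    ; k-mid = mid a<e e<d
    ; l-mid = mid a<f f<d
    }

-- The inversions of an irreducible permutation are generated under
-- transitivity by its extremal pairs of kinds (⊕ , ⊕) and (⊖ , ⊖).
irreducible⇒≤ : ∀ (z w : Perm n) → Irreducible z → (∀ s → ExtremeIncl s s z w) → z ≤ʷ w
irreducible⇒≤ {n} z w irr z⊆w a d inv = go (toℕ d) (ℕ.m≤m+n (toℕ d) (toℕ a)) inv
  where
  -- Induction on a bound `N` for the difference of `d` and `a`; initially `d` itself is one.
  go : ∀ N {a d} → toℕ d ℕ.≤ N ℕ.+ toℕ a → Inverted z a d → Inverted w a d
  go ℕ.zero d≤a (a<d , _) = contradiction a<d (ℕ.≤⇒≯ d≤a)
  go (ℕ.suc N) {a} {d} d≤N+a inv@(a<d , d◁a)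
    with any? (λ b → between? a b d ×-dec between? (pos z d) (pos z b) (pos z a))
       | any? (λ e → between? a e d ×-dec pos z e <? pos z d)
       | any? (λ f → between? a f d ×-dec pos z a <? pos z f)
  -- A value `b` between the two in size and in position splits the inversion into two shorter ones.
  ... | yes (b , (a<b , b<d) , (d◁b , b◁a)) | _ | _ = a<d , <-trans
          (proj₂ (go N {b} {d} (ℕ.≤-trans d≤N+a
                    (ℕ.≤-trans (ℕ.≤-reflexive (sym (ℕ.+-suc N _))) (ℕ.+-monoʳ-≤ N a<b))) (b<d , d◁b)))
          (proj₂ (go N {a} {b} (s≤s⁻¹ (ℕ.≤-trans b<d d≤N+a)) (a<b , b◁a)))
  -- No value between `a` and `d` stands left of `d`, so the pair belongs to T.
  ... | no _ | no none | _ = a<d , z⊆w ⊖ d a E a a<d (<-irrefl refl)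
    where
    E : Extreme ⊖ ⊖ z d a
    E b b<d b≮a with <-cmp a b
    ... | tri< a<b _ _ = ≮∧≢⇒> (λ b◁d → none (b , (a<b , b<d) , b◁d))
                               (λ e → <-irrefl (pos-injective z e) b<d)
    ... | tri≈ _ refl _ = d◁a
    ... | tri> _ _ b<a = contradiction b<a b≮a
  -- No value between `a` and `d` stands right of `a`, so the pair belongs to S.
  ... | no _ | yes _ | no none = a<d , z⊆w ⊕ a d E d a<d (<-irrefl refl)
    where
    E : Extreme ⊕ ⊕ z a d
    E b a<b d≮b with <-cmp b d
    ... | tri< b<d _ _ = ≮∧≢⇒> (λ a◁b → none (b , (a<b , b<d) , a◁b))
                               (λ e → <-irrefl (pos-injective z e) a<b)
    ... | tri≈ _ refl _ = d◁a
    ... | tri> _ _ d<b = contradiction d<b d≮b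
  -- Witnesses on both outer sides and none inside force a contractible descent.
  ... | no none | yes (e , e-mid , e◁d) | yes (f , f-mid , a◁f) =
    let _ , _ , D = crossing⇒contractible z inv (λ b h h′ → none (b , h , h′)) e-mid e◁d f-mid a◁f
    in contradiction D irr

-- The isomorphism

theorem9p7 : (n : ℕ) → n / 𝓗 ⟨3412,2413⟩ n ≅ TwistedBaxter n
theorem9p7 n = π↓ , record
  { isOrderMonomorphism = record
    { isOrderHomomorphism = record
      -- Congruent elements lie below each other in the quotient order, so `mono` applies both ways.
      { cong = λ {x} {y} x~y → ≤ʷ-antisym (nf x) (nf y)
          (mono (x , x , reflexive-𝓗 (λ _ → refl) , symmetric x~y , λ _ _ h → h))
          (mono (y , y , reflexive-𝓗 (λ _ → refl) , x~y , λ _ _ h → h))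
      ; mono = mono
      }
    ; injective = λ {x} {y} e → transitive (~nf x) (transitive (reflexive-𝓗 e) (symmetric (~nf y)))
    ; cancel    = λ {x} {y} h → nf x , nf y , ~nf x , ~nf y , h
    }
  -- A twisted Baxter `z` is its own preimage: `z` and the normal form of any `x ~ z` are
  -- irreducible with the same extremal pairs, so each lies below the other.
  ; surjective = λ (z , tb) → z , λ {x} x~z →
      let irr = twistedBaxter⇒irreducible {x = z} tb
          nfx≡z = 𝓗⇒≡ᵗᴮ {x = nf x} {z} (transitive (symmetric (~nf x)) x~z)
      in ≤ʷ-antisym (nf x) z
           (irreducible⇒≤ (nf x) z (nf-irreducible x) (λ s → proj₁ (nfx≡z s s)))
           (irreducible⇒≤ z (nf x) irr (λ s → proj₂ (nfx≡z s s)))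
  }
  where
  nf : Perm n → Perm n
  nf x = proj₁ (normalForm x)

  nf-irreducible : ∀ x → Irreducible (nf x)
  nf-irreducible x {k} {i} {j} {l} = proj₁ (proj₂ (normalForm x)) {k} {i} {j} {l}

  ~nf : ∀ x → x ~ nf x
  ~nf x = proj₂ (proj₂ (normalForm x))

  π↓ : Perm n → Σ (Perm n) IsTwistedBaxter
  π↓ x = nf x , irreducible⇒twistedBaxter (nf-irreducible x)

  mono : ∀ {x y} → QuotientOrder _~_ x y → nf x ≤ʷ nf y
  -- Extremal pairs are carried from `nf x` to `x′` by congruence, to `y′` by the weak order, and to
  -- `nf y` by congruence.
  mono {x} {y} (x′ , y′ , x~x′ , y~y′ , x′≤y′) = irreducible⇒≤ (nf x) (nf y) (nf-irreducible x) λ s a d →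
    proj₁ (𝓗⇒≡ᵗᴮ {x = y′} {nf y} (transitive (symmetric y~y′) (~nf y)) s s) a d ∘
    Weak⇒ExtremeIncl s s x′ y′ (≤ʷ⇒Weak s x′ y′ x′≤y′) a d ∘
    proj₁ (𝓗⇒≡ᵗᴮ {x = nf x} {x′} (transitive (symmetric (~nf x)) x~x′) s s) a d
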